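{- For $n\ge 2$, the number $h(n)$ of centered ascending polyominoes of semi-perimeter $n$ is \[h(n)=\frac{3n-5}{n-1}\binom{2n-5}{n-2},\] with the convention $\binom{ -1}{0}=1$ (so $h(2)=1$).
   Context: A polyomino is a finite edge-connected set of unit cells; it is convex if every row and column is a contiguous segment of cells; its semi-perimeter is the width plus the height of its minimal bounding rectangle. A NW-path inside $P$ is a sequence of cells of $P$, consecutive cells sharing an edge, each step going North or West; write $a\nwarrow b$ if such a path exists from $a$ to $b$, let $D_{NW}(a,b)$ be the minimum number of changes of direction over such paths, and $D_{NW}(P)=\max\{D_{NW}(a,b):a\nwarrow b\}$. A convex polyomino is ascending if $D_{NW}(P)\le1$. It is (horizontally) centered if it contains at least one row touching both the left and the right side of its minimal bounding rectangle. -}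

module Defs where

open import Data.Nat using (ℕ; zero; suc; _+_; _*_; _∸_; _≤_; _<_)
open import Data.Nat.Combinatorics using (_C_)
open import Data.Bool using (Bool; T)
open import Data.Fin using (Fin; fromℕ<)
open import Data.Vec using (Vec; lookup)
open import Data.List using (List; []; _∷_; length)
open import Data.List.Membership.Propositional using (_∈_)
open import Data.List.Relation.Unary.Unique.Propositional using (Unique)
open import Data.Product using (Σ; ∃; _×_; _,_)
open import Relation.Binary.PropositionalEquality using (_≡_; _≢_)
open import Function.Bundles using (_⇔_)

-- A polyomino of semi-perimeter w + h, normalised (translated) so that its
-- minimal bounding rectangle is [0,w) × [0,h).  Column x (0 ≤ x < w, growing
-- to the East), row y (0 ≤ y < h, growing to the North).
Grid : ℕ → ℕ → Set
Grid w h = Vec (Vec Bool h) w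

Cell : Set
Cell = ℕ × ℕ

Mem : ∀ {w h} → Grid w h → Cell → Set
Mem {w} {h} g (x , y) =
  Σ (x < w) λ p → Σ (y < h) λ q → T (lookup (lookup g (fromℕ< p)) (fromℕ< q))

data Adj : Cell → Cell → Set where
  east  : ∀ {x y} → Adj (x , y) (suc x , y)
  west  : ∀ {x y} → Adj (suc x , y) (x , y)
  north : ∀ {x y} → Adj (x , y) (x , suc y)
  south : ∀ {x y} → Adj (x , suc y) (x , y)

data Conn {w h} (g : Grid w h) : Cell → Cell → Set where
  here : ∀ {a} → Mem g a → Conn g a a
  step : ∀ {a b c} → Mem g a → Adj a b → Conn g b c → Conn g a c

EdgeConnected : ∀ {w h} → Grid w h → Set
EdgeConnected g = ∀ a b → Mem g a → Mem g b → Conn g a b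

-- the minimal bounding rectangle is exactly [0,w) × [0,h):
-- some cell in column 0, in column w-1, in row 0 and in row h-1
TouchesSides : ∀ {w h} → Grid w h → Set
TouchesSides {w} {h} g =
  (∃ λ y → Mem g (0 , y)) × (∃ λ y → Mem g (w ∸ 1 , y)) ×
  (∃ λ x → Mem g (x , 0)) × (∃ λ x → Mem g (x , h ∸ 1))

Convex : ∀ {w h} → Grid w h → Set
Convex g =
  (∀ x₁ x x₂ y → x₁ ≤ x → x ≤ x₂ → Mem g (x₁ , y) → Mem g (x₂ , y) → Mem g (x , y)) ×
  (∀ x y₁ y y₂ → y₁ ≤ y → y ≤ y₂ → Mem g (x , y₁) → Mem g (x , y₂) → Mem g (x , y))

IsConvexPolyomino : ∀ {w h} → Grid w h → Set
IsConvexPolyomino g = TouchesSides g × EdgeConnected g × Convex g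

data Dir : Set where
  N W : Dir

data NWPath {w h} (g : Grid w h) : Cell → Cell → List Dir → Set where
  here  : ∀ {a} → Mem g a → NWPath g a a []
  stepN : ∀ {x y b ds} → Mem g (x , y) → NWPath g (x , suc y) b ds →
          NWPath g (x , y) b (N ∷ ds)
  stepW : ∀ {x y b ds} → Mem g (suc x , y) → NWPath g (x , y) b ds →
          NWPath g (suc x , y) b (W ∷ ds)

changes : List Dir → ℕ
changes [] = 0
changes (_ ∷ []) = 0
changes (N ∷ N ∷ ds) = changes (N ∷ ds)
changes (W ∷ W ∷ ds) = changes (W ∷ ds)
changes (N ∷ W ∷ ds) = suc (changes (W ∷ ds))
changes (W ∷ N ∷ ds) = suc (changes (N ∷ ds))

_↖⟨_⟩_ : ∀ {w h} → Cell → Grid w h → Cell → Set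
a ↖⟨ g ⟩ b = ∃ λ ds → NWPath g a b ds

-- D_NW(P) ≤ 1, i.e. max over a ↖ b of (min over NW-paths of #changes) ≤ 1
Ascending : ∀ {w h} → Grid w h → Set
Ascending g = ∀ a b → a ↖⟨ g ⟩ b →
  ∃ λ ds → NWPath g a b ds × changes ds ≤ 1

Centered : ∀ {w h} → Grid w h → Set
Centered {w} g = ∃ λ y → Mem g (0 , y) × Mem g (w ∸ 1 , y)

-- a (translation class of a) polyomino, given with its bounding box size
Shape : Set
Shape = Σ ℕ λ w → Σ ℕ λ h → Grid w h

CenteredAscendingOfSemiPerimeter : ℕ → Shape → Set
CenteredAscendingOfSemiPerimeter n (w , h , g) =
  w + h ≡ n × IsConvexPolyomino g × Ascending g × Centered g

HasCount : (Shape → Set) → ℕ → Set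
HasCount P k = ∃ λ (L : List Shape) → Unique L × (∀ s → (s ∈ L) ⇔ P s) × length L ≡ k

{-# OPTIONS --safe #-}
module Submission where

-- Let b be the lowest full row.  The rows below b, read downwards, and the rows
-- above b, read upwards, are two nested stacks of intervals; writing a row as
-- (right indentation , left indentation), the polyomino is ascending iff no row x
-- below and row y above have proj₁ x < proj₁ y and proj₂ y < proj₂ x.
-- Such a pair of stacks is encoded by letters: a full row of either stack, or the
-- removal of one outer column from each stack.  Each letter adds one to the
-- semi-perimeter, and δ records how far the two stacks have been shifted apart.
-- With A m δ the number of unrestricted words, the transfer recursion collapses to
--   A (m+1) δ = 2 A m δ + Σ_{i ≤ δ+1} C(2m+1, m+1+i),   A m 0 = C(2m+1, m+1),
-- and, as the row next to b on the lower side is not full, the count for n = m + 2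
-- is A m 0 − A (m−1) 0.

open import Defs
open import Data.Bool using (Bool; true; false; if_then_else_; _∨_; T; T?)
open import Data.Empty using (⊥; ⊥-elim)
open import Data.Fin using (Fin; toℕ; fromℕ<)
open import Data.Fin.Properties using (toℕ-fromℕ<; fromℕ<-toℕ; toℕ<n)
open import Data.List using (List; []; _∷_; _++_; _ʳ++_; length; map; concatMap; replicate; reverse; applyUpTo; applyDownFrom)
open import Data.List.Properties using (length-map; length-++; length-ʳ++; length-applyUpTo; length-applyDownFrom; map-injective; ʳ++-defn; reverse-injective; ∷-injective)
open import Data.List.Membership.Propositional using (_∈_)
open import Data.List.Membership.Propositional.Properties using (∈-map⁺; ∈-map⁻; ∈-concatMap⁺; ∈-concatMap⁻)
open import Data.List.Relation.Unary.All as All using (All; []; _∷_)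
import Data.List.Relation.Unary.All.Properties as All
open import Data.List.Relation.Unary.AllPairs as AllPairs using (AllPairs; []; _∷_)
import Data.List.Relation.Unary.AllPairs.Properties as AllPairs
open import Data.List.Relation.Unary.Any as Any using (here; there)
open import Data.List.Relation.Unary.Any.Properties using (reverse⁻)
open import Data.List.Relation.Unary.Unique.Propositional using (Unique)
import Data.List.Relation.Unary.Unique.Propositional.Properties as Unique
open import Data.Maybe using (Maybe; just; nothing)
open import Data.Nat
open import Data.Nat.Combinatorics using (_C_; nCk+nC[k+1]≡[n+1]C[k+1]; nCk≡nC[n∸k])
open import Data.Nat.ListAction using (sum)
open import Data.Nat.Properties
open import Data.Nat.Solver using (module +-*-Solver)
open import Data.Product using (∃; _×_; _,_; proj₁; proj₂)
open import Data.Sum using (_⊎_; inj₁; inj₂; [_,_]′)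
open import Data.Unit using (tt)
open import Data.Vec using (lookup; tabulate)
open import Data.Vec.Properties using (lookup∘tabulate; tabulate∘lookup; tabulate-cong)
open import Function using (_∘_; id)
open import Function.Bundles using (_⇔_; mk⇔; Equivalence)
open import Relation.Binary.PropositionalEquality
open import Relation.Nullary using (¬_; Dec; yes; no)
open import Relation.Nullary.Decidable using (_×-dec_; map′; ⌊_⌋; toWitness; fromWitness)
open import Relation.Unary using (Decidable)

open Equivalence using (to; from)

-- The width is shared by the two stacks, so a column letter has to act on both at once, and a first
-- row indented on both sides leaves a choice of column. The choice is made oppositely: right below
-- and left above whenever possible. Removing these two columns weakens the compatibility condition,
-- removing the two fallback columns strengthens it, each time by one in both alternatives, and
-- removing equal sides leaves it alone; hence the single number `δ`. A double fallback at `δ = 0`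
-- is exactly a forbidden pair of first rows, so compatibility needs no test beyond `δ` never
-- becoming negative. The price is the flags: a fallback is legitimate only if the shorter stack is
-- flush with the preferred side. In the counts the flags disappear again. Relations between flagged
-- counts leave `free` and `pend₁₂`, and `crossing (suc m) e + free m e` obeys the recurrence with
-- coefficients 1, 2, 1 that two steps of Pascal's rule give for sums along an odd row. The
-- vanishing of `crossing` at 0 is the boundary condition that matches the symmetry of that row.

-- Codes of pairs of stacks and their enumeration letter by letter

Row : Set
Row = ℕ × ℕ

data Side : Set where
  right left : Side

shift : Side → Row → Row
shift right (i , j) = suc i , j
shift left  (i , j) = i , suc j

record Code : Set where
  constructor code
  field
    excess : ℕ
    below above : List Row

addBelow addAbove : Code → Code
addBelow (code a xs ys) = code a ((0 , 0) ∷ xs) ys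
addAbove (code a xs ys) = code a xs ((0 , 0) ∷ ys)

-- The excess is the width less one and belongs to both stacks, so one letter gives a column back to
-- each of them, on sides chosen separately.
untrim : Side → Side → Code → Code
untrim d e (code a xs ys) = code (suc a) (map (shift d) xs) (map (shift e) ys)

data Kind : Set where
  fullBelow fullAbove : Kind
  trimmed : Side → Side → Kind

kinds : List Kind
kinds = fullBelow ∷ fullAbove ∷ trimmed right right ∷ trimmed right left ∷
        trimmed left right ∷ trimmed left left ∷ []

-- The flags ask that the first row below be flush with the right side (p), that
-- the first row above be flush with the left side (q), and that the first row below
-- not be full (z).  Trimming below on the left and above on the right is the fallback
-- used when the other side is flush, which the flags then carry on; after a full row
-- above, z makes the order of full rows canonical.
mutual
  codes : (p q z : Bool) → ℕ → ℕ → List Code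
  codes p q z zero    δ = if p ∨ q then [] else code 0 [] [] ∷ []
  codes p q z (suc m) δ = concatMap (piece p q z m δ) kinds

  piece : (p q z : Bool) → ℕ → ℕ → Kind → List Code
  piece p q z m δ fullBelow               = if z then [] else map addBelow (codes false q false m δ)
  piece p q z m δ fullAbove               = map addAbove (codes p false true m δ)
  piece p q z m δ (trimmed right right)   =
    if p then [] else map (untrim right right) (codes false true false m δ)
  piece p q z m δ (trimmed right left)    =
    if p ∨ q then [] else map (untrim right left) (codes false false false m (suc δ))
  piece p q z m δ (trimmed left left)     =
    if q then [] else map (untrim left left) (codes true false false m δ)
  piece p q z m zero (trimmed left right) = []
  piece p q z m (suc δ) (trimmed left right) = map (untrim left right) (codes true true false m δ)

mutual
  count : (p q z : Bool) → ℕ → ℕ → ℕ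
  count p q z zero    δ = if p ∨ q then 0 else 1
  count p q z (suc m) δ = sum (map (pieceCount p q z m δ) kinds)

  pieceCount : (p q z : Bool) → ℕ → ℕ → Kind → ℕ
  pieceCount p q z m δ fullBelow             = if z then 0 else count false q false m δ
  pieceCount p q z m δ fullAbove             = count p false true m δ
  pieceCount p q z m δ (trimmed right right) = if p then 0 else count false true false m δ
  pieceCount p q z m δ (trimmed right left)  = if p ∨ q then 0 else count false false false m (suc δ)
  pieceCount p q z m δ (trimmed left right)  = crossing m δ
  pieceCount p q z m δ (trimmed left left)   = if q then 0 else count true false false m δ

  -- The flags drop out here: a double fallback leaves both stacks flush with the sides that `p` and
  -- `q` may ask for and no first row full, so one number serves every choice of flags.
  crossing : ℕ → ℕ → ℕ
  crossing m zero    = 0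
  crossing m (suc δ) = count true true false m δ

length-concatMap : ∀ {A B : Set} {f : A → List B} {g : A → ℕ} →
                   (∀ x → length (f x) ≡ g x) → ∀ xs → length (concatMap f xs) ≡ sum (map g xs)
length-concatMap eq []       = refl
length-concatMap {f = f} eq (x ∷ xs) = trans (length-++ (f x)) (cong₂ _+_ (eq x) (length-concatMap eq xs))

length-if : ∀ {A : Set} b {xs : List A} {k} → length xs ≡ k →
            length (if b then [] else xs) ≡ (if b then 0 else k)
length-if true  eq = refl
length-if false eq = eq

mutual
  length-codes : ∀ p q z m δ → length (codes p q z m δ) ≡ count p q z m δ
  length-codes p q z zero    δ = length-if (p ∨ q) {code 0 [] [] ∷ []} refl
  length-codes p q z (suc m) δ = length-concatMap {f = piece p q z m δ} (length-piece p q z m δ) kinds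

  length-piece : ∀ p q z m δ k → length (piece p q z m δ k) ≡ pieceCount p q z m δ k
  length-piece p q z m δ fullBelow             = length-if z (length-map-codes m δ)
  length-piece p q z m δ fullAbove             = length-map-codes m δ
  length-piece p q z m δ (trimmed right right) = length-if p (length-map-codes m δ)
  length-piece p q z m δ (trimmed right left)  = length-if (p ∨ q) (length-map-codes m (suc δ))
  length-piece p q z m zero (trimmed left right)    = refl
  length-piece p q z m (suc δ) (trimmed left right) = length-map-codes m δ
  length-piece p q z m δ (trimmed left left)   = length-if q (length-map-codes m δ)

  length-map-codes : ∀ {f : Code → Code} {p q z} m δ →
                     length (map f (codes p q z m δ)) ≡ count p q z m δ
  length-map-codes {f} {p} {q} {z} m δ = trans (length-map f (codes p q z m δ)) (length-codes p q z m δ)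

-- Relations between the flagged counts

-- Six of the eight flag settings suffice: in the recursion `z` is raised only by a full row above,
-- which discharges `q`. Index 1 stands for `p`, index 2 for `q`, a prime for `z`.
free free′ pend₁ pend₁′ pend₂ pend₁₂ : ℕ → ℕ → ℕ
free   = count false false false
free′  = count false false true
pend₁  = count true false false
pend₁′ = count true false true
pend₂  = count false true false
pend₁₂ = count true true false

-- A half-turn exchanges the stacks and the two flags. The order imposed on full rows breaks this
-- symmetry in the recursion; `swap-marks` measures the defect and is proved in the same induction.
pend₁≡pend₂ : ∀ m δ → pend₁ m δ ≡ pend₂ m δ
-- A leading full row below is the surplus of `free` over `free′` and also of `pend₁` over `pend₁′`.
-- It discharges `p`, so the two surpluses are equal.
swap-marks  : ∀ m δ → free m δ + pend₁′ m δ ≡ pend₂ m δ + free′ m δ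
pend₁≡pend₂ zero δ = refl
pend₁≡pend₂ (suc m) δ = begin
  A + (B′ + (X + (B + 0))) ≡⟨ solve 4 (λ a b′ x b → a :+ (b′ :+ (x :+ (b :+ con 0))) := (a :+ b′) :+ (x :+ b)) refl A B′ X B ⟩
  (A + B′) + (X + B)       ≡⟨ cong₂ (λ s b → s + (X + b)) (swap-marks m δ) (pend₁≡pend₂ m δ) ⟩
  (Q + A′) + (X + Q)       ≡⟨ solve 3 (λ c a′ x → (c :+ a′) :+ (x :+ c) := c :+ (a′ :+ (c :+ (x :+ con 0)))) refl Q A′ X ⟩
  Q + (A′ + (Q + (X + 0))) ∎
  where
  open ≡-Reasoning
  open +-*-Solver
  A = free m δ
  A′ = free′ m δ
  B = pend₁ m δ
  B′ = pend₁′ m δ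
  Q = pend₂ m δ
  X = crossing m δ
swap-marks zero δ = refl
swap-marks (suc m) δ = begin
  (A + A′) + B′  ≡⟨ solve 3 (λ a a′ b′ → (a :+ a′) :+ b′ := (a :+ b′) :+ a′) refl A A′ B′ ⟩
  (A + B′) + A′  ≡⟨ cong (_+ A′) (pend₁≡pend₂ (suc m) δ) ⟩
  pend₂ (suc m) δ + A′ ∎
  where
  open ≡-Reasoning
  open +-*-Solver
  A = free m δ
  A′ = free′ (suc m) δ
  B′ = pend₁′ (suc m) δ

-- Compared through `pend₁`: also asking for `q` turns the `free` words after a full row below into
-- `pend₂` words and forbids trimming both stacks on the left. By `pend₁≡pend₂` the forbidden words
-- are as many as the new ones, so the net loss is `free m δ`.
pend₂-step : ∀ m δ → pend₂ (suc m) δ ≡ pend₁₂ (suc m) δ + free m δ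
pend₂-step m δ = begin
  pend₂ (suc m) δ           ≡⟨ pend₁≡pend₂ (suc m) δ ⟨
  A + (B′ + (X + (B + 0)))  ≡⟨ cong (λ b → A + (B′ + (X + (b + 0)))) (pend₁≡pend₂ m δ) ⟩
  A + (B′ + (X + (Q + 0)))  ≡⟨ solve 4 (λ a b′ x c → a :+ (b′ :+ (x :+ (c :+ con 0))) := (c :+ (b′ :+ (x :+ con 0))) :+ a) refl A B′ X Q ⟩
  (Q + (B′ + (X + 0))) + A  ∎
  where
  open ≡-Reasoning
  open +-*-Solver
  A = free m δ
  B = pend₁ m δ
  B′ = pend₁′ m δ
  Q = pend₂ m δ
  X = crossing m δ

free-step : ∀ m δ → free (suc m) δ ≡ pend₂ (suc m) δ + free m δ + free m (suc δ)
free-step m δ = begin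
  A + (A′ + (Q + (A₊ + (X + (B + 0)))))  ≡⟨ cong (λ b → A + (A′ + (Q + (A₊ + (X + (b + 0)))))) (pend₁≡pend₂ m δ) ⟩
  A + (A′ + (Q + (A₊ + (X + (Q + 0)))))  ≡⟨ solve 5 (λ a a′ a₊ c x → a :+ (a′ :+ (c :+ (a₊ :+ (x :+ (c :+ con 0))))) := (c :+ (a′ :+ (c :+ (x :+ con 0)))) :+ a :+ a₊) refl A A′ A₊ Q X ⟩
  pend₂ (suc m) δ + A + A₊               ∎
  where
  open ≡-Reasoning
  open +-*-Solver
  A = free m δ
  A′ = free′ m δ
  A₊ = free m (suc δ)
  B = pend₁ m δ
  Q = pend₂ m δ
  X = crossing m δ

-- Binomial sums and the closed form

-- A segment of an odd row of Pascal's triangle, starting at the right one of its two central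
-- entries. One more letter corresponds to two rows of the triangle.
upperSum : ℕ → ℕ → ℕ
upperSum k zero    = (1 + 2 * k) C (1 + k)
upperSum k (suc e) = upperSum k e + (1 + 2 * k) C (2 + k + e)

pascal : ∀ n k → suc n C suc k ≡ n C k + n C suc k
pascal n k = sym (nCk+nC[k+1]≡[n+1]C[k+1] n k)

pascal² : ∀ n k → (2 + n) C (2 + k) ≡ n C k + 2 * (n C (1 + k)) + n C (2 + k)
pascal² n k = begin
  (2 + n) C (2 + k)                                   ≡⟨ pascal (1 + n) (1 + k) ⟩
  (1 + n) C (1 + k) + (1 + n) C (2 + k)               ≡⟨ cong₂ _+_ (pascal n k) (pascal n (1 + k)) ⟩
  (n C k + n C (1 + k)) + (n C (1 + k) + n C (2 + k)) ≡⟨ solve 3 (λ a b c → (a :+ b) :+ (b :+ c) := a :+ con 2 :* b :+ c) refl (n C k) (n C (1 + k)) (n C (2 + k)) ⟩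
  n C k + 2 * (n C (1 + k)) + n C (2 + k)             ∎
  where
  open ≡-Reasoning
  open +-*-Solver

central-sym : ∀ k → (1 + 2 * k) C k ≡ (1 + 2 * k) C (1 + k)
central-sym k = trans (nCk≡nC[n∸k] k≤) (cong ((1 + 2 * k) C_) eq)
  where
  k≤ : k ≤ 1 + 2 * k
  k≤ = ≤-trans (m≤m+n k (k + 0)) (n≤1+n _)
  eq : 1 + 2 * k ∸ k ≡ 1 + k
  eq = begin
    1 + 2 * k ∸ k   ≡⟨ cong (_∸ k) (solve 1 (λ k → con 1 :+ con 2 :* k := (con 1 :+ k) :+ k) refl k) ⟩
    (1 + k) + k ∸ k ≡⟨ m+n∸n≡m (1 + k) k ⟩
    1 + k           ∎
    where
    open ≡-Reasoning
    open +-*-Solver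

2*suc : ∀ k → 1 + 2 * suc k ≡ 2 + (1 + 2 * k)
2*suc k = cong suc (*-suc 2 k)

-- This is `upperSum-suc` at the boundary, the missing third term being an empty sum. The entry left
-- of the centre is reflected to the right by `central-sym`.
upperSum-zero : ∀ k → upperSum (suc k) 0 ≡ upperSum k 1 + 2 * upperSum k 0
upperSum-zero k = begin
  (1 + 2 * suc k) C (2 + k)                      ≡⟨ cong (_C (2 + k)) (2*suc k) ⟩
  (2 + n) C (2 + k)                              ≡⟨ pascal² n k ⟩
  n C k + 2 * (n C (1 + k)) + n C (2 + k)        ≡⟨ cong (λ t → t + 2 * (n C (1 + k)) + n C (2 + k)) (central-sym k) ⟩
  n C (1 + k) + 2 * (n C (1 + k)) + n C (2 + k)  ≡⟨ solve 2 (λ a b → a :+ con 2 :* a :+ b := (a :+ b) :+ con 2 :* a) refl (n C (1 + k)) (n C (2 + k)) ⟩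
  (n C (1 + k) + n C (2 + k)) + 2 * (n C (1 + k)) ≡⟨ cong (λ t → (n C (1 + k) + n C t) + 2 * (n C (1 + k))) (sym (+-identityʳ (2 + k))) ⟩
  upperSum k 1 + 2 * upperSum k 0                      ∎
  where
  open ≡-Reasoning
  open +-*-Solver
  n = 1 + 2 * k

-- `pascal²` splits the last summand into three entries, which extend the three sums supplied by the
-- induction on `e` by one place each.
upperSum-suc : ∀ k e → upperSum (suc k) (suc e) ≡ upperSum k (2 + e) + 2 * upperSum k (1 + e) + upperSum k e
upperSum-suc k e = begin
  upperSum (suc k) e + (1 + 2 * suc k) C (3 + k + e)
    ≡⟨ cong (λ t → upperSum (suc k) e + t C (3 + k + e)) (2*suc k) ⟩
  upperSum (suc k) e + (2 + n) C (3 + k + e)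
    ≡⟨ cong (upperSum (suc k) e +_) (pascal² n (1 + k + e)) ⟩
  upperSum (suc k) e + (n C (1 + k + e) + 2 * (n C (2 + k + e)) + n C (3 + k + e))
    ≡⟨ lemma e ⟩
  upperSum k (2 + e) + 2 * upperSum k (1 + e) + upperSum k e ∎
  where
  open ≡-Reasoning
  open +-*-Solver
  n = 1 + 2 * k
  lemma : ∀ e → upperSum (suc k) e + (n C (1 + k + e) + 2 * (n C (2 + k + e)) + n C (3 + k + e)) ≡
                upperSum k (2 + e) + 2 * upperSum k (1 + e) + upperSum k e
  lemma zero = begin
    upperSum (suc k) 0 + (n C (1 + k + 0) + 2 * c + n C (3 + k + 0))
      ≡⟨ cong₂ (λ s t → s + (n C t + 2 * c + n C (3 + k + 0))) (upperSum-zero k) (+-identityʳ (1 + k)) ⟩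
    (u + c + 2 * u) + (u + 2 * c + n C (3 + k + 0))
      ≡⟨ cong (λ t → (u + c + 2 * u) + (u + 2 * c + n C t)) (sym (+-suc (2 + k) 0)) ⟩
    (u + c + 2 * u) + (u + 2 * c + d)
      ≡⟨ solve 3 (λ u c d → (u :+ c :+ con 2 :* u) :+ (u :+ con 2 :* c :+ d) :=
                            (u :+ c :+ d) :+ con 2 :* (u :+ c) :+ u) refl u c d ⟩
    upperSum k 2 + 2 * upperSum k 1 + upperSum k 0 ∎
    where
    u = upperSum k 0
    c = n C (2 + k + 0)
    d = n C (2 + k + 1)
  lemma (suc e) = begin
    upperSum (suc k) (suc e) + (n C (1 + k + suc e) + 2 * (n C (2 + k + suc e)) + n C (3 + k + suc e))
      ≡⟨ cong₂ (λ s t → s + (n C t + 2 * c + n C (3 + k + suc e))) (upperSum-suc k e) (+-suc (1 + k) e) ⟩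
    (u + b + c + 2 * (u + b) + u) + (b + 2 * c + n C (3 + k + suc e))
      ≡⟨ cong (λ t → (u + b + c + 2 * (u + b) + u) + (b + 2 * c + n C t)) (sym (+-suc (2 + k) (suc e))) ⟩
    (u + b + c + 2 * (u + b) + u) + (b + 2 * c + d)
      ≡⟨ solve 4 (λ u b c d → (u :+ b :+ c :+ con 2 :* (u :+ b) :+ u) :+ (b :+ con 2 :* c :+ d) :=
                              (u :+ b :+ c :+ d) :+ con 2 :* (u :+ b :+ c) :+ (u :+ b)) refl u b c d ⟩
    upperSum k (3 + e) + 2 * upperSum k (2 + e) + upperSum k (1 + e) ∎
    where
    u = upperSum k e
    b = n C (2 + k + e)
    c = n C (2 + k + suc e)
    d = n C (2 + k + suc (suc e))

-- The left side is `crossing (suc m) e + free m e` at `e = suc δ`; at `e = 0` the same expression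
-- is `free m 0`. Extended in this way it satisfies the recurrence of `upperSum`, which is why the
-- three statements are proved by one induction.
pend₁₂-upperSum : ∀ m δ → pend₁₂ (suc m) δ + free m (suc δ) ≡ upperSum m (suc δ)
free-upperSum   : ∀ m δ → free (suc m) δ ≡ 2 * free m δ + upperSum m (suc δ)
free-zero    : ∀ m → free m 0 ≡ upperSum m 0

free-upperSum m δ = begin
  free (suc m) δ                              ≡⟨ free-step m δ ⟩
  pend₂ (suc m) δ + A + A₊                    ≡⟨ cong (λ t → t + A + A₊) (pend₂-step m δ) ⟩
  (pend₁₂ (suc m) δ + A) + A + A₊             ≡⟨ solve 3 (λ d a a₊ → (d :+ a) :+ a :+ a₊ := con 2 :* a :+ (d :+ a₊)) refl (pend₁₂ (suc m) δ) A A₊ ⟩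
  2 * A + (pend₁₂ (suc m) δ + A₊)             ≡⟨ cong (2 * A +_) (pend₁₂-upperSum m δ) ⟩
  2 * A + upperSum m (suc δ)                     ∎
  where
  open ≡-Reasoning
  open +-*-Solver
  A = free m δ
  A₊ = free m (suc δ)

free-zero zero    = refl
free-zero (suc m) = begin
  free (suc m) 0              ≡⟨ free-upperSum m 0 ⟩
  2 * free m 0 + upperSum m 1    ≡⟨ cong (λ t → 2 * t + upperSum m 1) (free-zero m) ⟩
  2 * upperSum m 0 + upperSum m 1   ≡⟨ +-comm (2 * upperSum m 0) (upperSum m 1) ⟩
  upperSum m 1 + 2 * upperSum m 0   ≡⟨ upperSum-zero m ⟨
  upperSum (suc m) 0             ∎
  where open ≡-Reasoning

crossing-upperSum : ∀ m δ → crossing (suc m) δ + free m δ ≡ upperSum m δ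
crossing-upperSum m zero    = free-zero m
crossing-upperSum m (suc δ) = pend₁₂-upperSum m δ

upperSum-0 : ∀ e → upperSum 0 e ≡ 1
upperSum-0 zero    = refl
upperSum-0 (suc e) = trans (+-identityʳ _) (upperSum-0 e)

pend₁₂-upperSum zero    zero    = refl
pend₁₂-upperSum zero    (suc δ) = sym (upperSum-0 (2 + δ))
pend₁₂-upperSum (suc m) δ = begin
  (Q + (B′ + (X + 0))) + free (suc m) (suc δ)
    ≡⟨ cong₂ (λ s t → (Q + (s + (X + 0))) + t) B′≡D (free-upperSum m (suc δ)) ⟩
  (Q + (D + (X + 0))) + (2 * A₊ + upperSum m (2 + δ))
    ≡⟨ cong (λ t → (t + (D + (X + 0))) + (2 * A₊ + upperSum m (2 + δ))) (pend₂-step m δ) ⟩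
  ((D + A) + (D + (X + 0))) + (2 * A₊ + upperSum m (2 + δ))
    ≡⟨ solve 5 (λ a a₊ d x u → ((d :+ a) :+ (d :+ (x :+ con 0))) :+ (con 2 :* a₊ :+ u) :=
                               u :+ con 2 :* (d :+ a₊) :+ (x :+ a)) refl A A₊ D X (upperSum m (2 + δ)) ⟩
  upperSum m (2 + δ) + 2 * (D + A₊) + (X + A)
    ≡⟨ cong₂ (λ s t → upperSum m (2 + δ) + 2 * s + t) (pend₁₂-upperSum m δ) (crossing-upperSum m δ) ⟩
  upperSum m (2 + δ) + 2 * upperSum m (1 + δ) + upperSum m δ
    ≡⟨ upperSum-suc m δ ⟨
  upperSum (suc m) (suc δ) ∎
  where
  open ≡-Reasoning
  open +-*-Solver
  A = free m δ
  A₊ = free m (suc δ)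
  B′ = pend₁′ (suc m) δ
  Q = pend₂ (suc m) δ
  D = pend₁₂ (suc m) δ
  X = crossing (suc m) δ
  B′≡D : B′ ≡ D
  -- `pend₁ (suc m) δ` unfolds to `A + B′`, the `A` words being those with a leading full row below.
  B′≡D = +-cancelˡ-≡ A _ _ (begin
    A + B′           ≡⟨ pend₁≡pend₂ (suc m) δ ⟩
    Q                ≡⟨ pend₂-step m δ ⟩
    D + A            ≡⟨ +-comm D A ⟩
    A + D            ∎)

absorption : ∀ n k → suc k * (suc n C suc k) ≡ suc n * (n C k)
absorption zero    zero    = refl
absorption zero    (suc k) = *-zeroʳ (2 + k)
absorption (suc n) zero    = begin
  1 * (suc (suc n) C 1)       ≡⟨ *-identityˡ _ ⟩
  suc (suc n) C 1             ≡⟨ pascal (suc n) 0 ⟩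
  1 + suc n C 1               ≡⟨ cong suc (sym (*-identityˡ _)) ⟩
  1 + 1 * (suc n C 1)         ≡⟨ cong suc (absorption n 0) ⟩
  suc (suc n) * 1             ∎
  where open ≡-Reasoning
absorption (suc n) (suc k) = begin
  (2 + k) * ((2 + n) C (2 + k))           ≡⟨ cong ((2 + k) *_) (pascal (1 + n) (1 + k)) ⟩
  (2 + k) * (x + y)                       ≡⟨ solve 3 (λ k x y → (con 2 :+ k) :* (x :+ y) := (con 1 :+ k) :* x :+ x :+ (con 2 :+ k) :* y) refl k x y ⟩
  (1 + k) * x + x + (2 + k) * y           ≡⟨ cong₂ (λ s t → s + x + t) (absorption n k) (absorption n (suc k)) ⟩
  suc n * (n C k) + x + suc n * (n C suc k) ≡⟨ solve 4 (λ n x a b → n :* a :+ x :+ n :* b := n :* (a :+ b) :+ x) refl (suc n) x (n C k) (n C suc k) ⟩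
  suc n * (n C k + n C suc k) + x         ≡⟨ cong (λ t → suc n * t + x) (sym (pascal n k)) ⟩
  suc n * x + x                           ≡⟨ +-comm (suc n * x) x ⟩
  (2 + n) * x                             ∎
  where
  open ≡-Reasoning
  open +-*-Solver
  x = suc n C suc k
  y = suc n C (2 + k)

-- For `m = suc k`, `free (suc k) 0` is `c + F`, and absorption gives `(c + F) * M = 2 (2k + 3) c`.
-- Taking away `c * M = (k + 2) c` leaves the factor `3k + 4`; the subtraction is done by cancelling
-- `c * M`.
free′-closed : ∀ m → free′ m 0 * suc m ≡ (3 * (2 + m) ∸ 5) * ((2 * (2 + m) ∸ 5) C m)
-- Truncated subtraction turns the upper index -1 into 0, and 0 C 0 = 1 is the value that the
-- convention prescribes.
free′-closed zero = refl
free′-closed (suc k) = begin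
  F * M                            ≡⟨ +-cancelˡ-≡ (c * M) _ _ total ⟩
  (4 + 3 * k) * c                  ≡⟨ cong₂ _*_ (cong (_∸ 5) 3*) (cong (λ t → (t ∸ 5) C suc k) 2*) ⟨
  (3 * (3 + k) ∸ 5) * ((2 * (3 + k) ∸ 5) C suc k) ∎
  where
  open ≡-Reasoning
  open +-*-Solver
  F = free′ (suc k) 0
  M = 2 + k
  n = 1 + 2 * k
  c = n C suc k
  3* : 3 * (3 + k) ≡ 5 + (4 + 3 * k)
  3* = solve 1 (λ k → con 3 :* (con 3 :+ k) := con 5 :+ (con 4 :+ con 3 :* k)) refl k
  2* : 2 * (3 + k) ≡ 5 + n
  2* = solve 1 (λ k → con 2 :* (con 3 :+ k) := con 5 :+ (con 1 :+ con 2 :* k)) refl k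
  total : c * M + F * M ≡ c * M + (4 + 3 * k) * c
  total = begin
    c * M + F * M              ≡⟨ *-distribʳ-+ M c F ⟨
    (c + F) * M                ≡⟨ cong (λ t → (t + F) * M) (sym (free-zero k)) ⟩
    free (suc k) 0 * M         ≡⟨ cong (_* M) (free-zero (suc k)) ⟩
    ((1 + 2 * suc k) C M) * M  ≡⟨ *-comm ((1 + 2 * suc k) C M) M ⟩
    M * ((1 + 2 * suc k) C M)  ≡⟨ cong (λ t → M * (t C M)) (2*suc k) ⟩
    M * ((2 + n) C M)          ≡⟨ absorption (suc n) (suc k) ⟩
    (2 + n) * (suc n C suc k)  ≡⟨ cong ((2 + n) *_) (pascal n k) ⟩
    (2 + n) * (n C k + c)      ≡⟨ cong (λ t → (2 + n) * (t + c)) (central-sym k) ⟩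
    (2 + n) * (c + c)          ≡⟨ solve 2 (λ k c → (con 2 :+ (con 1 :+ con 2 :* k)) :* (c :+ c) := c :* (con 2 :+ k) :+ (con 4 :+ con 3 :* k) :* c) refl k c ⟩
    c * M + (4 + 3 * k) * c    ∎

-- Valid codes and the effect of trimming on them

coord : Side → Row → ℕ
coord right = proj₁
coord left  = proj₂

other : Side → Side
other right = left
other left  = right

infix 4 _≼_
_≼_ : Row → Row → Set
x ≼ y = proj₁ x ≤ proj₁ y × proj₂ x ≤ proj₂ y

weight : Row → ℕ
weight (i , j) = i + j

-- At `δ = 0` this negates the forbidden pair. A column given back on the right below and on the
-- left above helps one alternative through `x` and the other through `y`, so the same `δ` fits
-- both.
data Compatible (δ : ℕ) (x y : Row) : Set where
  byRight : proj₁ y ≤ proj₁ x + δ → Compatible δ x y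
  byLeft  : proj₂ x ≤ proj₂ y + δ → Compatible δ x y

-- An empty stack is not flush: a flag stems from a fallback, which needs a first row, whereas an
-- empty stack counts as trimmed on the preferred side.
Head : (Row → Set) → List Row → Set
Head P []      = ⊥
Head P (x ∷ _) = P x

Flush : Side → List Row → Set
Flush d = Head λ x → coord d x ≡ 0

StartsFull : List Row → Set
StartsFull = Head (_≡ (0 , 0))

record Stack (a : ℕ) (xs : List Row) : Set where
  constructor _,_
  field
    fits   : All (λ x → weight x ≤ a) xs
    nested : AllPairs _≼_ xs

-- The excess is the width less one and the base row is not stored, so `m` is the semi-perimeter
-- less two.
record Valid (p q z : Bool) (m δ : ℕ) (c : Code) : Set where
  constructor valid
  open Code c
  field
    size          : excess + (length below + length above) ≡ m
    below-stack   : Stack excess below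
    above-stack   : Stack excess above
    compatible    : All (λ x → All (Compatible δ x) above) below
    below-flush   : T p → Flush right below
    above-flush   : T q → Flush left above
    below-notFull : T z → ¬ StartsFull below

weight-shift : ∀ d x → weight (shift d x) ≡ suc (weight x)
weight-shift right x       = refl
weight-shift left  (i , j) = +-suc i j

≼-shift⁺ : ∀ d {x y} → x ≼ y → shift d x ≼ shift d y
≼-shift⁺ right (p , q) = s≤s p , q
≼-shift⁺ left  (p , q) = p , s≤s q

≼-shift⁻ : ∀ d {x y} → shift d x ≼ shift d y → x ≼ y
≼-shift⁻ right (p , q) = s≤s⁻¹ p , q
≼-shift⁻ left  (p , q) = p , s≤s⁻¹ q

stack-shift⁺ : ∀ d {a xs} → Stack a xs → Stack (suc a) (map (shift d) xs)
stack-shift⁺ d (f , n) =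
  All.map⁺ (All.map (λ {x} w → ≤-trans (≤-reflexive (weight-shift d x)) (s≤s w)) f) ,
  AllPairs.map⁺ (AllPairs.map (≼-shift⁺ d) n)

stack-shift⁻ : ∀ d {a xs} → Stack (suc a) (map (shift d) xs) → Stack a xs
stack-shift⁻ d (f , n) =
  All.map (λ {x} w → s≤s⁻¹ (≤-trans (≤-reflexive (sym (weight-shift d x))) w)) (All.map⁻ f) ,
  AllPairs.map (≼-shift⁻ d) (AllPairs.map⁻ n)

stack-∷ : ∀ {a xs} → Stack a xs → Stack a ((0 , 0) ∷ xs)
stack-∷ (f , n) = (z≤n ∷ f) , (All.tabulate (λ _ → z≤n , z≤n) ∷ n)

stack-tail : ∀ {a x xs} → Stack a (x ∷ xs) → Stack a xs
stack-tail (_ ∷ f , _ ∷ n) = f , n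

compatible-map⁺ : ∀ {δ δ′} d e → (∀ {x y} → Compatible δ x y → Compatible δ′ (shift d x) (shift e y)) →
                  ∀ {xs ys} → All (λ x → All (Compatible δ x) ys) xs →
                  All (λ x → All (Compatible δ′ x) (map (shift e) ys)) (map (shift d) xs)
compatible-map⁺ d e f h = All.map⁺ (All.map (λ h′ → All.map⁺ (All.map f h′)) h)

compatible-map⁻ : ∀ {δ δ′} d e → (∀ {x y} → Compatible δ (shift d x) (shift e y) → Compatible δ′ x y) →
                  ∀ {xs ys} → All (λ x → All (Compatible δ x) (map (shift e) ys)) (map (shift d) xs) →
                  All (λ x → All (Compatible δ′ x) ys) xs
compatible-map⁻ d e f h = All.map (λ h′ → All.map f (All.map⁻ h′)) (All.map⁻ h)

compatible-same⁺ : ∀ {δ} d {x y} → Compatible δ x y → Compatible δ (shift d x) (shift d y)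
compatible-same⁺ right (byRight p) = byRight (s≤s p)
compatible-same⁺ right (byLeft p) = byLeft p
compatible-same⁺ left  (byRight p) = byRight p
compatible-same⁺ left  (byLeft p) = byLeft (s≤s p)

compatible-same⁻ : ∀ {δ} d {x y} → Compatible δ (shift d x) (shift d y) → Compatible δ x y
compatible-same⁻ right (byRight p) = byRight (s≤s⁻¹ p)
compatible-same⁻ right (byLeft p) = byLeft p
compatible-same⁻ left  (byRight p) = byRight p
compatible-same⁻ left  (byLeft p) = byLeft (s≤s⁻¹ p)

compatible-apart⁺ : ∀ {δ x y} → Compatible (suc δ) x y → Compatible δ (shift right x) (shift left y)
compatible-apart⁺ (byRight p) = byRight (≤-trans p (≤-reflexive (+-suc _ _)))
compatible-apart⁺ (byLeft p) = byLeft (≤-trans p (≤-reflexive (+-suc _ _)))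

compatible-apart⁻ : ∀ {δ x y} → Compatible δ (shift right x) (shift left y) → Compatible (suc δ) x y
compatible-apart⁻ (byRight p) = byRight (≤-trans p (≤-reflexive (sym (+-suc _ _))))
compatible-apart⁻ (byLeft p) = byLeft (≤-trans p (≤-reflexive (sym (+-suc _ _))))

compatible-cross⁺ : ∀ {δ x y} → Compatible δ x y → Compatible (suc δ) (shift left x) (shift right y)
compatible-cross⁺ (byRight p) = byRight (≤-trans (s≤s p) (≤-reflexive (sym (+-suc _ _))))
compatible-cross⁺ (byLeft p) = byLeft (≤-trans (s≤s p) (≤-reflexive (sym (+-suc _ _))))

compatible-cross⁻ : ∀ {δ x y} → Compatible (suc δ) (shift left x) (shift right y) → Compatible δ x y
compatible-cross⁻ (byRight p) = byRight (s≤s⁻¹ (≤-trans p (≤-reflexive (+-suc _ _))))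
compatible-cross⁻ (byLeft p) = byLeft (s≤s⁻¹ (≤-trans p (≤-reflexive (+-suc _ _))))

compatible-full-below : ∀ {δ ys} → All (Compatible δ (0 , 0)) ys
compatible-full-below = All.tabulate (λ _ → byLeft z≤n)

compatible-full-above : ∀ {δ ys xs} → All (λ x → All (Compatible δ x) ys) xs →
                        All (λ x → All (Compatible δ x) ((0 , 0) ∷ ys)) xs
compatible-full-above = All.map (byRight z≤n ∷_)

flush-other : ∀ d xs → Flush d xs → Flush d (map (shift (other d)) xs)
flush-other right (x ∷ xs) f = f
flush-other left  (x ∷ xs) f = f

flush-shift⁻ : ∀ d xs → ¬ Flush d (map (shift d) xs)
flush-shift⁻ right (x ∷ xs) ()
flush-shift⁻ left  (x ∷ xs) ()

shift-notFull : ∀ d xs → ¬ StartsFull (map (shift d) xs)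
shift-notFull right (x ∷ xs) ()
shift-notFull left  (x ∷ xs) ()

-- nothing stands for a full first row; d is the side trimmed whenever possible.
first : Side → List Row → Maybe Side
first d []                          = just d
first d ((zero  , zero)  ∷ _)       = nothing
first right ((suc _ , _) ∷ _)       = just right
first right ((zero  , suc _) ∷ _)   = just left
first left  ((_ , suc _) ∷ _)       = just left
first left  ((suc _ , zero) ∷ _)    = just right

kind′ : Maybe Side → Maybe Side → Kind
kind′ nothing  _        = fullBelow
kind′ (just d) nothing  = fullAbove
kind′ (just d) (just e) = trimmed d e

-- Recovers the outermost letter from the code alone, which makes the pieces of `codes` disjoint.
kind : Code → Kind
kind (code a xs ys) = kind′ (first right xs) (first left ys)

first-shift : ∀ d xs → first d (map (shift d) xs) ≡ just d
first-shift right []             = refl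
first-shift left  []             = refl
first-shift right ((i , j) ∷ xs) = refl
first-shift left  ((zero , j) ∷ xs) = refl
first-shift left  ((suc i , j) ∷ xs) = refl

first-other : ∀ d xs → Flush d xs → first d (map (shift (other d)) xs) ≡ just (other d)
first-other right ((zero , j) ∷ xs) refl = refl
first-other left  ((i , zero) ∷ xs) refl = refl

first-notFull : ∀ d xs → ¬ StartsFull xs → ∃ λ e → first d xs ≡ just e
first-notFull d     []                       _ = d , refl
first-notFull d     ((zero , zero) ∷ xs)     n = ⊥-elim (n refl)
first-notFull right ((suc i , j) ∷ xs)       _ = _ , refl
first-notFull right ((zero , suc j) ∷ xs)    _ = _ , refl
first-notFull left  ((zero , suc j) ∷ xs)    _ = _ , refl
first-notFull left  ((suc i , suc j) ∷ xs)   _ = _ , refl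
first-notFull left  ((suc i , zero) ∷ xs)    _ = _ , refl

∈-if : ∀ {A : Set} {x : A} b {xs} → x ∈ (if b then [] else xs) → ¬ T b × x ∈ xs
∈-if false x∈ = id , x∈

if-∈ : ∀ {A : Set} {x : A} b {xs} → ¬ T b → x ∈ xs → x ∈ (if b then [] else xs)
if-∈ false _ x∈ = x∈
if-∈ true  n _  = ⊥-elim (n tt)

¬T∨ : ∀ b c → ¬ T (b ∨ c) → ¬ T b × ¬ T c
¬T∨ false c n = id , n
¬T∨ true  c n = ⊥-elim (n tt)

∨¬T : ∀ b c → ¬ T b → ¬ T c → ¬ T (b ∨ c)
∨¬T false c _ n = n
∨¬T true  c n _ = n

size-trim : ∀ a {m} d e (xs ys : List Row) → a + (length xs + length ys) ≡ m →
            suc a + (length (map (shift d) xs) + length (map (shift e) ys)) ≡ suc m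
size-trim a d e xs ys eq =
  cong suc (trans (cong (a +_) (cong₂ _+_ (length-map (shift d) xs) (length-map (shift e) ys))) eq)

-- The enumeration yields valid codes, without repetition

mutual
  codes-valid : ∀ p q z m δ {c} → c ∈ codes p q z m δ → Valid p q z m δ c
  codes-valid p q z zero δ c∈ with ∈-if (p ∨ q) c∈
  ... | n , here refl = valid refl ([] , []) ([] , []) [] (⊥-elim ∘ proj₁ (¬T∨ p q n)) (⊥-elim ∘ proj₂ (¬T∨ p q n)) λ _ → id
  codes-valid p q z (suc m) δ c∈ with Any.satisfied (∈-concatMap⁻ (piece p q z m δ) {xs = kinds} c∈)
  ... | k , c∈k = proj₁ (piece-valid p q z m δ k c∈k)

  -- Both conclusions rest on the flags of the shorter code: flushness is what shows that a column
  -- was removed as a fallback and not by preference.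
  piece-valid : ∀ p q z m δ k {c} → c ∈ piece p q z m δ k → Valid p q z (suc m) δ c × kind c ≡ k
  piece-valid p q z m δ fullBelow c∈ with ∈-if z c∈
  ... | nz , c∈ with ∈-map⁻ addBelow c∈
  ... | code a xs ys , c′∈ , refl with codes-valid false q false m δ c′∈
  ... | valid s b t o _ g _ =
    valid (trans (+-suc a _) (cong suc s)) (stack-∷ b) t (compatible-full-below ∷ o) (λ _ → refl) g (⊥-elim ∘ nz) , refl
  piece-valid p q z m δ fullAbove c∈ with ∈-map⁻ addAbove c∈
  ... | code a xs ys , c′∈ , refl with codes-valid p false true m δ c′∈
  -- The raised `z` keeps this letter from being read as a full row below.
  ... | valid s b t o f g n with first-notFull right xs (n tt)
  ... | d , eq =
    valid (trans (cong (a +_) (+-suc (length xs) _)) (trans (+-suc a _) (cong suc s))) b (stack-∷ t) (compatible-full-above o) f (λ _ → refl) (λ _ → n tt) ,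
    cong (λ k → kind′ k nothing) eq
  piece-valid p q z m δ (trimmed right right) c∈ with ∈-if p c∈
  ... | np , c∈ with ∈-map⁻ (untrim right right) c∈
  ... | code a xs ys , c′∈ , refl with codes-valid false true false m δ c′∈
  ... | valid s b t o f g n =
    valid (size-trim a right right xs ys s) (stack-shift⁺ right b) (stack-shift⁺ right t)
      (compatible-map⁺ right right (compatible-same⁺ right) o) (⊥-elim ∘ np) (λ _ → flush-other left ys (g tt)) (λ _ → shift-notFull right xs) ,
    cong₂ kind′ (first-shift right xs) (first-other left ys (g tt))
  piece-valid p q z m δ (trimmed right left) c∈ with ∈-if (p ∨ q) c∈
  ... | npq , c∈ with ∈-map⁻ (untrim right left) c∈
  ... | code a xs ys , c′∈ , refl with codes-valid false false false m (suc δ) c′∈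
  ... | valid s b t o f g n =
    valid (size-trim a right left xs ys s) (stack-shift⁺ right b) (stack-shift⁺ left t)
      (compatible-map⁺ right left compatible-apart⁺ o) (⊥-elim ∘ proj₁ (¬T∨ p q npq)) (⊥-elim ∘ proj₂ (¬T∨ p q npq))
      (λ _ → shift-notFull right xs) ,
    cong₂ kind′ (first-shift right xs) (first-shift left ys)
  piece-valid p q z m (suc δ) (trimmed left right) c∈ with ∈-map⁻ (untrim left right) c∈
  ... | code a xs ys , c′∈ , refl with codes-valid true true false m δ c′∈
  ... | valid s b t o f g n =
    valid (size-trim a left right xs ys s) (stack-shift⁺ left b) (stack-shift⁺ right t)
      (compatible-map⁺ left right compatible-cross⁺ o) (λ _ → flush-other right xs (f tt)) (λ _ → flush-other left ys (g tt))
      (λ _ → shift-notFull left xs) ,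
    cong₂ kind′ (first-other right xs (f tt)) (first-other left ys (g tt))
  piece-valid p q z m δ (trimmed left left) c∈ with ∈-if q c∈
  ... | nq , c∈ with ∈-map⁻ (untrim left left) c∈
  ... | code a xs ys , c′∈ , refl with codes-valid true false false m δ c′∈
  ... | valid s b t o f g n =
    valid (size-trim a left left xs ys s) (stack-shift⁺ left b) (stack-shift⁺ left t)
      (compatible-map⁺ left left (compatible-same⁺ left) o) (λ _ → flush-other right xs (f tt)) (⊥-elim ∘ nq) (λ _ → shift-notFull left xs) ,
    cong₂ kind′ (first-other right xs (f tt)) (first-shift left ys)

unique-concatMap : ∀ {A B : Set} {f : A → List B} (g : B → A) → (∀ k {c} → c ∈ f k → g c ≡ k) →
                   (∀ k → Unique (f k)) → ∀ {ks} → Unique ks → Unique (concatMap f ks)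
unique-concatMap {f = f} g gf uf {ks} uks =
  Unique.concat⁺ (All.map⁺ (All.tabulate (λ {k} _ → uf k)))
    (AllPairs.map⁺ (AllPairs.map (λ {k} {k′} k≢k′ {c} (c∈ , c∈′) → k≢k′ (trans (sym (gf k c∈)) (gf k′ c∈′))) uks))

unique-if : ∀ {A : Set} b {xs : List A} → Unique xs → Unique (if b then [] else xs)
unique-if true  u = []
unique-if false u = u

shift-injective : ∀ d {x y} → shift d x ≡ shift d y → x ≡ y
shift-injective right refl = refl
shift-injective left  refl = refl

addBelow-injective : ∀ {c c′} → addBelow c ≡ addBelow c′ → c ≡ c′
addBelow-injective refl = refl

addAbove-injective : ∀ {c c′} → addAbove c ≡ addAbove c′ → c ≡ c′
addAbove-injective refl = refl

untrim-injective : ∀ d e {c c′} → untrim d e c ≡ untrim d e c′ → c ≡ c′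
untrim-injective d e {code a xs ys} {code a′ xs′ ys′} eq
  with suc-injective (cong Code.excess eq)
     | map-injective (shift-injective d) (cong Code.below eq)
     | map-injective (shift-injective e) (cong Code.above eq)
... | refl | refl | refl = refl

unique-kinds : Unique kinds
unique-kinds = ((λ ()) ∷ (λ ()) ∷ (λ ()) ∷ (λ ()) ∷ (λ ()) ∷ []) ∷
  ((λ ()) ∷ (λ ()) ∷ (λ ()) ∷ (λ ()) ∷ []) ∷ ((λ ()) ∷ (λ ()) ∷ (λ ()) ∷ []) ∷
  ((λ ()) ∷ (λ ()) ∷ []) ∷ ((λ ()) ∷ []) ∷ [] ∷ []

mutual
  codes-unique : ∀ p q z m δ → Unique (codes p q z m δ)
  codes-unique p q z zero    δ = unique-if (p ∨ q) ([] ∷ [])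
  codes-unique p q z (suc m) δ =
    unique-concatMap kind (λ k → proj₂ ∘ piece-valid p q z m δ k) (piece-unique p q z m δ) unique-kinds

  piece-unique : ∀ p q z m δ k → Unique (piece p q z m δ k)
  piece-unique p q z m δ fullBelow             = unique-if z (Unique.map⁺ addBelow-injective (codes-unique _ _ _ m δ))
  piece-unique p q z m δ fullAbove             = Unique.map⁺ addAbove-injective (codes-unique _ _ _ m δ)
  piece-unique p q z m δ (trimmed right right) = unique-if p (Unique.map⁺ (untrim-injective right right) (codes-unique _ _ _ m δ))
  piece-unique p q z m δ (trimmed right left)  = unique-if (p ∨ q) (Unique.map⁺ (untrim-injective right left) (codes-unique _ _ _ m (suc δ)))
  piece-unique p q z m zero (trimmed left right)    = []
  piece-unique p q z m (suc δ) (trimmed left right) = Unique.map⁺ (untrim-injective left right) (codes-unique _ _ _ m δ)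
  piece-unique p q z m δ (trimmed left left)   = unique-if q (Unique.map⁺ (untrim-injective left left) (codes-unique _ _ _ m δ))

-- The enumeration reaches every valid code

-- `d` is the preferred side. The flushness kept by `forced` becomes the flag `p` or `q` of the
-- shorter code.
data Decomposition (d : Side) : List Row → Set where
  startsFull : ∀ {zs} xs → zs ≡ (0 , 0) ∷ xs → Decomposition d zs
  preferred : ∀ {zs} xs → zs ≡ map (shift d) xs → Decomposition d zs
  forced    : ∀ {zs} xs → zs ≡ map (shift (other d)) xs → Flush d xs → Decomposition d zs

unshift : ∀ d {xs} → All (λ x → 1 ≤ coord d x) xs → ∃ λ ys → xs ≡ map (shift d) ys
unshift d [] = [] , refl
unshift right {(suc i , j) ∷ xs} (s≤s _ ∷ h) with unshift right h
... | ys , refl = (i , j) ∷ ys , refl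
unshift left {(i , suc j) ∷ xs} (s≤s _ ∷ h) with unshift left h
... | ys , refl = (i , j) ∷ ys , refl

coord-mono : ∀ d {x y} → x ≼ y → coord d x ≤ coord d y
coord-mono right = proj₁
coord-mono left  = proj₂

-- Indentations only grow away from the base, so a column missing from the first row is missing from
-- all.
unshift-nested : ∀ d {x xs} → AllPairs _≼_ (x ∷ xs) → 1 ≤ coord d x → ∃ λ ys → x ∷ xs ≡ map (shift d) ys
unshift-nested d (h ∷ _) p = unshift d (p ∷ All.map (λ le → ≤-trans p (coord-mono d le)) h)

decompose : ∀ d {xs} → AllPairs _≼_ xs → Decomposition d xs
decompose d [] = preferred [] refl
decompose d     {(zero , zero) ∷ xs} n = startsFull xs refl
decompose right {(suc i , j) ∷ xs} n with unshift-nested right n (s≤s z≤n)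
... | ys , eq = preferred ys eq
decompose right {(zero , suc j) ∷ xs} n with unshift-nested left n (s≤s z≤n)
... | (i , k) ∷ ys , refl = forced (_ ∷ _) refl refl
decompose left {(i , suc j) ∷ xs} n with unshift-nested left n (s≤s z≤n)
... | ys , eq = preferred ys eq
decompose left {(suc i , zero) ∷ xs} n with unshift-nested right n (s≤s z≤n)
... | (k , j) ∷ ys , refl = forced (_ ∷ _) refl refl

shift-excess : ∀ d {xs} → Stack 0 (map (shift d) xs) → xs ≡ []
shift-excess d {[]}     s = refl
shift-excess d {x ∷ xs} (w ∷ _ , _) with ≤-trans (≤-reflexive (sym (weight-shift d x))) w
... | ()

piece-∈ : ∀ p q z m δ k {c} → k ∈ kinds → c ∈ piece p q z m δ k → c ∈ codes p q z (suc m) δ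
piece-∈ p q z m δ k k∈ c∈ = ∈-concatMap⁺ (piece p q z m δ) (Any.map (λ { refl → c∈ }) k∈)

-- In width one no row can be indented, so both stacks are empty and nothing accounts for a positive
-- size.
no-excess : ∀ d e {m xs ys} {P : Set} → Stack 0 (map (shift d) xs) → Stack 0 (map (shift e) ys) →
            length (map (shift d) xs) + length (map (shift e) ys) ≡ suc m → P
no-excess d e b t s with shift-excess d b | shift-excess e t
no-excess d e b t () | refl | refl

size-trim⁻ : ∀ a {m} d e (xs ys : List Row) →
             suc a + (length (map (shift d) xs) + length (map (shift e) ys)) ≡ suc m →
             a + (length xs + length ys) ≡ m
size-trim⁻ a d e xs ys eq =
  trans (cong (a +_) (sym (cong₂ _+_ (length-map (shift d) xs) (length-map (shift e) ys)))) (suc-injective eq)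

-- The two first rows are a forbidden pair: the lower reaches the right side but not the left, the
-- upper the left side but not the right.
crossed : ∀ xs ys → Flush right xs → Flush left ys →
          ¬ All (λ x → All (Compatible 0 x) (map (shift right) ys)) (map (shift left) xs)
crossed ((zero , _) ∷ xs) ((_ , zero) ∷ ys) refl refl ((byRight () ∷ _) ∷ _)
crossed ((zero , _) ∷ xs) ((_ , zero) ∷ ys) refl refl ((byLeft () ∷ _) ∷ _)

codes-complete : ∀ p q z m δ {c} → Valid p q z m δ c → c ∈ codes p q z m δ
codes-complete p q z zero δ {code zero [] []} (valid s b t o f g n) = if-∈ (p ∨ q) (∨¬T p q f g) (here refl)
codes-complete p q z (suc m) δ {code a xs ys} (valid s b t o f g n)
  with decompose right (Stack.nested b) | decompose left (Stack.nested t)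
codes-complete p q z (suc m) δ {code a _ ys} (valid s b t o f g n) | startsFull xs refl | _ =
  piece-∈ p q z m δ fullBelow (here refl) (if-∈ z (λ z → n z refl) (∈-map⁺ addBelow (codes-complete false q false m δ
    (valid (suc-injective (trans (sym (+-suc a _)) s)) (stack-tail b) t (All.tail o) (λ ()) g λ ()))))
codes-complete p q z (suc m) δ {code a _ _} (valid s b t o f g n) | preferred xs refl | startsFull ys refl =
  piece-∈ p q z m δ fullAbove (there (here refl)) (∈-map⁺ addAbove (codes-complete p false true m δ
    (valid (suc-injective (trans (sym (trans (cong (a +_) (+-suc (length (map (shift right) xs)) _)) (+-suc a _))) s)) b (stack-tail t) (All.map All.tail o) f (λ ())
      (λ _ → shift-notFull right xs))))
codes-complete p q z (suc m) δ {code a _ _} (valid s b t o f g n) | forced xs refl h | startsFull ys refl =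
  piece-∈ p q z m δ fullAbove (there (here refl)) (∈-map⁺ addAbove (codes-complete p false true m δ
    (valid (suc-injective (trans (sym (trans (cong (a +_) (+-suc (length (map (shift left) xs)) _)) (+-suc a _))) s)) b (stack-tail t) (All.map All.tail o) f (λ ())
      (λ _ → shift-notFull left xs))))
codes-complete p q z (suc m) δ {code zero _ _} (valid s b t o f g n) | preferred xs refl | preferred ys refl = no-excess right left {xs = xs} {ys} b t s
codes-complete p q z (suc m) δ {code zero _ _} (valid s b t o f g n) | preferred xs refl | forced ys refl h = no-excess right right {xs = xs} {ys} b t s
codes-complete p q z (suc m) δ {code zero _ _} (valid s b t o f g n) | forced xs refl h | preferred ys refl = no-excess left left {xs = xs} {ys} b t s
codes-complete p q z (suc m) δ {code zero _ _} (valid s b t o f g n) | forced xs refl h | forced ys refl h′ = no-excess left right {xs = xs} {ys} b t s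
codes-complete p q z (suc m) δ {code (suc a) _ _} (valid s b t o f g n) | preferred xs refl | preferred ys refl =
  piece-∈ p q z m δ (trimmed right left) (there (there (there (here refl))))
    (if-∈ (p ∨ q) (∨¬T p q (flush-shift⁻ right xs ∘ f) (flush-shift⁻ left ys ∘ g))
      (∈-map⁺ (untrim right left) (codes-complete false false false m (suc δ) (valid (size-trim⁻ a right left xs ys s)
        (stack-shift⁻ right b) (stack-shift⁻ left t) (compatible-map⁻ right left compatible-apart⁻ o) (λ ()) (λ ()) (λ ())))))
codes-complete p q z (suc m) δ {code (suc a) _ _} (valid s b t o f g n) | preferred xs refl | forced ys refl h =
  piece-∈ p q z m δ (trimmed right right) (there (there (here refl)))
    (if-∈ p (flush-shift⁻ right xs ∘ f)
      (∈-map⁺ (untrim right right) (codes-complete false true false m δ (valid (size-trim⁻ a right right xs ys s)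
        (stack-shift⁻ right b) (stack-shift⁻ right t) (compatible-map⁻ right right (compatible-same⁻ right) o) (λ ()) (λ _ → h) (λ ())))))
codes-complete p q z (suc m) δ {code (suc a) _ _} (valid s b t o f g n) | forced xs refl h | preferred ys refl =
  piece-∈ p q z m δ (trimmed left left) (there (there (there (there (there (here refl))))))
    (if-∈ q (flush-shift⁻ left ys ∘ g)
      (∈-map⁺ (untrim left left) (codes-complete true false false m δ (valid (size-trim⁻ a left left xs ys s)
        (stack-shift⁻ left b) (stack-shift⁻ left t) (compatible-map⁻ left left (compatible-same⁻ left) o) (λ _ → h) (λ ()) (λ ())))))
codes-complete p q z (suc m) zero {code (suc a) _ _} (valid s b t o f g n) | forced xs refl h | forced ys refl h′ = ⊥-elim (crossed xs ys h h′ o)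
codes-complete p q z (suc m) (suc δ) {code (suc a) _ _} (valid s b t o f g n) | forced xs refl h | forced ys refl h′ =
  piece-∈ p q z m (suc δ) (trimmed left right) (there (there (there (there (here refl)))))
    (∈-map⁺ (untrim left right) (codes-complete true true false m δ (valid (size-trim⁻ a left right xs ys s)
        (stack-shift⁻ left b) (stack-shift⁻ right t) (compatible-map⁻ left right compatible-cross⁻ o) (λ _ → h) (λ _ → h′) (λ ()))))

-- Connectivity and NW-paths in convex grids

conn-∷ʳ : ∀ {w h} {g : Grid w h} {a b c} → Conn g a b → Adj b c → Mem g c → Conn g a c
conn-∷ʳ (here m)     e m′ = step m e (here m′)
conn-∷ʳ (step m e p) e′ m′ = step m e (conn-∷ʳ p e′ m′)

adj-sym : ∀ {a b} → Adj a b → Adj b a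
adj-sym east  = west
adj-sym west  = east
adj-sym north = south
adj-sym south = north

conn-sym : ∀ {w h} {g : Grid w h} {a b} → Conn g a b → Conn g b a
conn-sym (here m)     = here m
conn-sym (step m e p) = conn-∷ʳ (conn-sym p) (adj-sym e) m

conn-trans : ∀ {w h} {g : Grid w h} {a b c} → Conn g a b → Conn g b c → Conn g a c
conn-trans (here _)     q = q
conn-trans (step m e p) q = step m e (conn-trans p q)

nw⇒conn : ∀ {w h} {g : Grid w h} {a b ds} → NWPath g a b ds → Conn g a b
nw⇒conn (here m)    = here m
nw⇒conn (stepN m p) = step m north (nw⇒conn p)
nw⇒conn (stepW m p) = step m west (nw⇒conn p)

nw-source : ∀ {w h} {g : Grid w h} {a b ds} → NWPath g a b ds → Mem g a
nw-source (here m)    = m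
nw-source (stepN m _) = m
nw-source (stepW m _) = m

nw-target : ∀ {w h} {g : Grid w h} {a b ds} → NWPath g a b ds → Mem g b
nw-target (here m)    = m
nw-target (stepN _ p) = nw-target p
nw-target (stepW _ p) = nw-target p

nw-north : ∀ {w h} {g : Grid w h} {x y x′ y′ ds} → NWPath g (x , y) (x′ , y′) ds → y ≤ y′
nw-north (here _)    = ≤-refl
nw-north (stepN _ p) = ≤-trans (n≤1+n _) (nw-north p)
nw-north (stepW _ p) = nw-north p

nw-west : ∀ {w h} {g : Grid w h} {x y x′ y′ ds} → NWPath g (x , y) (x′ , y′) ds → x′ ≤ x
nw-west (here _)    = ≤-refl
nw-west (stepN _ p) = nw-west p
nw-west (stepW _ p) = ≤-trans (nw-west p) (n≤1+n _)

module _ {w h} {g : Grid w h} (convex : Convex g) where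

  go-north : ∀ k {x y y′ b ds} → k + y ≡ y′ → Mem g (x , y) → NWPath g (x , y′) b ds →
             NWPath g (x , y) b (replicate k N ++ ds)
  go-north zero    refl m p = p
  go-north (suc k) {x} {y} refl m p = stepN m (go-north k (+-suc k y)
    (proj₂ convex x y (suc y) (suc (k + y)) (n≤1+n y) (s≤s (m≤n+m y k)) m (nw-source p)) p)

  go-west : ∀ k {x x′ y b ds} → k + x′ ≡ x → Mem g (x , y) → NWPath g (x′ , y) b ds →
            NWPath g (x , y) b (replicate k W ++ ds)
  go-west zero    refl m p = p
  go-west (suc k) {x} {x′} {y} refl m p = stepW m (go-west k refl
    (proj₁ convex x′ (k + x′) (suc (k + x′)) y (m≤n+m x′ k) (n≤1+n _) (nw-source p) m) p)

  column-conn : ∀ {x y y′} → Mem g (x , y) → Mem g (x , y′) → Conn g (x , y) (x , y′)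
  column-conn {x} {y} {y′} m m′ with ≤-total y y′
  ... | inj₁ y≤y′ = nw⇒conn (go-north (y′ ∸ y) (m∸n+n≡m y≤y′) m (here m′))
  ... | inj₂ y′≤y = conn-sym (nw⇒conn (go-north (y ∸ y′) (m∸n+n≡m y′≤y) m′ (here m)))

  row-conn : ∀ {x x′ y} → Mem g (x , y) → Mem g (x′ , y) → Conn g (x , y) (x′ , y)
  row-conn {x} {x′} m m′ with ≤-total x x′
  ... | inj₁ x≤x′ = conn-sym (nw⇒conn (go-west (x′ ∸ x) (m∸n+n≡m x≤x′) m′ (here m)))
  ... | inj₂ x′≤x = nw⇒conn (go-west (x ∸ x′) (m∸n+n≡m x′≤x) m (here m′))

changes-N* : ∀ k → changes (replicate k N ++ []) ≡ 0
changes-N* zero          = refl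
changes-N* (suc zero)    = refl
changes-N* (suc (suc k)) = changes-N* (suc k)

changes-W* : ∀ k → changes (replicate k W ++ []) ≡ 0
changes-W* zero          = refl
changes-W* (suc zero)    = refl
changes-W* (suc (suc k)) = changes-W* (suc k)

changes-N*W* : ∀ k l → changes (replicate k N ++ replicate l W ++ []) ≤ 1
changes-N*W* zero          l       = ≤-trans (≤-reflexive (changes-W* l)) z≤n
changes-N*W* (suc zero)    zero    = z≤n
changes-N*W* (suc zero)    (suc l) = s≤s (≤-reflexive (changes-W* (suc l)))
changes-N*W* (suc (suc k)) l       = changes-N*W* (suc k) l

changes-W*N* : ∀ k l → changes (replicate k W ++ replicate l N ++ []) ≤ 1
changes-W*N* zero          l       = ≤-trans (≤-reflexive (changes-N* l)) z≤n
changes-W*N* (suc zero)    zero    = z≤n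
changes-W*N* (suc zero)    (suc l) = s≤s (≤-reflexive (changes-N* (suc l)))
changes-W*N* (suc (suc k)) l       = changes-W*N* (suc k) l

-- The two possible turning points of a path with at most one turn. In a convex grid the presence of
-- either one suffices for such a path, so ascending becomes a condition on cells.
Corner : ∀ {w h} → Grid w h → Cell → Cell → Set
Corner g (x , y) (x′ , y′) = Mem g (x , y′) ⊎ Mem g (x′ , y)

corner⇒path : ∀ {w h} {g : Grid w h} → Convex g → ∀ {x y x′ y′} → x′ ≤ x → y ≤ y′ →
              Mem g (x , y) → Mem g (x′ , y′) → Corner g (x , y) (x′ , y′) →
              ∃ λ ds → NWPath g (x , y) (x′ , y′) ds × changes ds ≤ 1
corner⇒path convex {x} {y} {x′} {y′} x′≤x y≤y′ m m′ (inj₁ c) = _ ,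
  go-north convex (y′ ∸ y) (m∸n+n≡m y≤y′) m (go-west convex (x ∸ x′) (m∸n+n≡m x′≤x) c (here m′)) ,
  changes-N*W* (y′ ∸ y) (x ∸ x′)
corner⇒path convex {x} {y} {x′} {y′} x′≤x y≤y′ m m′ (inj₂ c) = _ ,
  go-west convex (x ∸ x′) (m∸n+n≡m x′≤x) m (go-north convex (y′ ∸ y) (m∸n+n≡m y≤y′) c (here m′)) ,
  changes-W*N* (x ∸ x′) (y′ ∸ y)

straight-west : ∀ {w h} {g : Grid w h} {x y x′ y′ ds} → NWPath g (x , y) (x′ , y′) (W ∷ ds) →
                changes (W ∷ ds) ≤ 0 → y′ ≡ y
straight-west (stepW _ (here _))        _ = refl
straight-west (stepW _ p@(stepW _ _))   c = straight-west p c

straight-north : ∀ {w h} {g : Grid w h} {x y x′ y′ ds} → NWPath g (x , y) (x′ , y′) (N ∷ ds) →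
                 changes (N ∷ ds) ≤ 0 → x′ ≡ x
straight-north (stepN _ (here _))        _ = refl
straight-north (stepN _ p@(stepN _ _))   c = straight-north p c

-- After its only turn the path is straight, so the turning cell already lies in the row of the
-- endpoint.
corner-north : ∀ {w h} {g : Grid w h} {x y x′ y′ ds} → NWPath g (x , y) (x′ , y′) (N ∷ ds) →
               changes (N ∷ ds) ≤ 1 → Mem g (x , y′)
corner-north (stepN _ (here m))      _ = m
corner-north (stepN _ p@(stepN _ _)) c = corner-north p c
corner-north {g = g} {x} (stepN _ p@(stepW m _)) (s≤s c) =
  subst (λ y → Mem g (x , y)) (sym (straight-west p c)) m

corner-west : ∀ {w h} {g : Grid w h} {x y x′ y′ ds} → NWPath g (x , y) (x′ , y′) (W ∷ ds) →
              changes (W ∷ ds) ≤ 1 → Mem g (x′ , y)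
corner-west (stepW _ (here m))      _ = m
corner-west (stepW _ p@(stepW _ _)) c = corner-west p c
corner-west {g = g} {y = y} (stepW _ p@(stepN m _)) (s≤s c) =
  subst (λ x → Mem g (x , y)) (sym (straight-north p c)) m

path⇒corner : ∀ {w h} {g : Grid w h} {x y x′ y′ ds} → NWPath g (x , y) (x′ , y′) ds →
              changes ds ≤ 1 → Corner g (x , y) (x′ , y′)
path⇒corner (here m)      _ = inj₁ m
path⇒corner p@(stepN _ _) c = inj₁ (corner-north p c)
path⇒corner p@(stepW _ _) c = inj₂ (corner-west p c)

-- Grids described by the indentations of their rows

Inside : ℕ → Row → ℕ → Set
Inside a (i , j) x = j ≤ x × i + x ≤ a

inside-≼ : ∀ {a r r′ x} → r ≼ r′ → Inside a r′ x → Inside a r x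
inside-≼ {x = x} (p , q) (s , t) = ≤-trans q s , ≤-trans (+-monoˡ-≤ x p) t

-- The meeting point of the two directions of the bijection: a code provides it through its list of
-- rows, a polyomino by measuring its rows. Values of `rows` from `h` on are left free.
record Profile {a h} (g : Grid (suc a) h) (b : ℕ) (rows : ℕ → Row) : Set where
  field
    base<h     : b < h
    mem        : ∀ {x y} → Mem g (x , y) ⇔ (y < h × Inside a (rows y) x)
    fits       : ∀ {y} → y < h → weight (rows y) ≤ a
    full       : rows b ≡ (0 , 0)
    below      : ∀ {y y′} → y ≤ y′ → y′ ≤ b → rows y′ ≼ rows y
    above      : ∀ {y y′} → b ≤ y → y ≤ y′ → y′ < h → rows y ≼ rows y′
    compatible : ∀ {y y′} → y < b → b < y′ → y′ < h → Compatible 0 (rows y) (rows y′)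

module _ {a h} {g : Grid (suc a) h} {b rows} (P : Profile g b rows) where
  open Profile P

  private
    base-cell : ∀ {x} → x ≤ a → Mem g (x , b)
    base-cell {x} x≤a = from mem (base<h , subst (λ r → Inside a r x) (sym full) (z≤n , x≤a))

    leftmost : ∀ {y} → y < h → ∃ λ x → Mem g (x , y)
    leftmost {y} y<h = proj₂ (rows y) , from mem (y<h , ≤-refl , fits y<h)

    to-base : ∀ {x y} → Mem g (x , y) → Mem g (x , b)
    to-base m = base-cell (≤-trans (m≤n+m _ _) (proj₂ (proj₂ (to mem m))))

  profile-touches : TouchesSides g
  profile-touches = (b , base-cell z≤n) , (b , base-cell ≤-refl) ,
    leftmost (≤-<-trans z≤n base<h) , leftmost (h∸1<h base<h)
    where
    h∸1<h : ∀ {n k} → n < k → k ∸ 1 < k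
    h∸1<h (s≤s _) = ≤-refl

  profile-convex : Convex g
  profile-convex = rowwise , columnwise
    where
    rowwise : ∀ x₁ x x₂ y → x₁ ≤ x → x ≤ x₂ → Mem g (x₁ , y) → Mem g (x₂ , y) → Mem g (x , y)
    rowwise x₁ x x₂ y p q m₁ m₂ with to mem m₁ | to mem m₂
    ... | y<h , l , _ | _ , _ , r = from mem (y<h , ≤-trans l p , ≤-trans (+-monoʳ-≤ _ q) r)

    columnwise : ∀ x y₁ y y₂ → y₁ ≤ y → y ≤ y₂ → Mem g (x , y₁) → Mem g (x , y₂) → Mem g (x , y)
    columnwise x y₁ y y₂ p q m₁ m₂ with to mem m₁ | to mem m₂ | ≤-total y b
    ... | _ , i₁ | y₂<h , i₂ | inj₁ y≤b = from mem (≤-<-trans q y₂<h , inside-≼ (below p y≤b) i₁)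
    ... | _ , i₁ | y₂<h , i₂ | inj₂ b≤y = from mem (≤-<-trans q y₂<h , inside-≼ (above b≤y q y₂<h) i₂)

  profile-connected : EdgeConnected g
  profile-connected (x , y) (x′ , y′) m m′ =
    -- Row `b` is full, so each cell reaches it within its own column.
    conn-trans (column-conn profile-convex m (to-base m))
      (conn-trans (row-conn profile-convex (to-base m) (to-base m′))
        (column-conn profile-convex (to-base m′) m′))

  profile-ascending : Ascending g
  profile-ascending (x , y) (x′ , y′) (_ , p) =
    corner⇒path profile-convex x′≤x y≤y′ m m′ corner
    where
    x′≤x = nw-west p
    y≤y′ = nw-north p
    m = nw-source p
    m′ = nw-target p
    -- With both rows on one side of `b`, nesting supplies a corner; only rows strictly on either
    -- side of `b` call for `compatible`.
    corner : Corner g (x , y) (x′ , y′)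
    corner with to mem m | to mem m′ | ≤-<-connex y′ b | ≤-<-connex b y
    ... | _ , i | y′<h , i′ | inj₁ y′≤b | _ = inj₁ (from mem (y′<h , inside-≼ (below y≤y′ y′≤b) i))
    ... | y<h , i | y′<h , i′ | _ | inj₁ b≤y = inj₂ (from mem (y<h , inside-≼ (above b≤y y≤y′ y′<h) i′))
    ... | y<h , l , r | y′<h , l′ , r′ | inj₂ b<y′ | inj₂ y<b with compatible y<b b<y′ y′<h
    ... | byRight c = inj₁ (from mem (y′<h , ≤-trans l′ x′≤x ,
                        ≤-trans (+-monoˡ-≤ x (≤-trans c (≤-reflexive (+-identityʳ _)))) r))
    ... | byLeft  c = inj₂ (from mem (y<h , ≤-trans (≤-trans c (≤-reflexive (+-identityʳ _))) l′ ,
                        ≤-trans (+-monoʳ-≤ _ x′≤x) r))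

  profile-centered : Centered g
  profile-centered = b , base-cell z≤n , base-cell ≤-refl

-- The profile of a centered ascending polyomino

-- The bound itself is returned untested when the search fails; `least-spec` speaks only of searches
-- with a witness.
least : ∀ {P : ℕ → Set} → Decidable P → ℕ → ℕ
least P? zero    = zero
least P? (suc n) with P? 0
... | yes _ = 0
... | no  _ = suc (least (P? ∘ suc) n)

least-spec : ∀ {P : ℕ → Set} (P? : Decidable P) n {i} → i ≤ n → P i → P (least P? n) × least P? n ≤ i
least-spec P? zero {zero} _ p = p , z≤n
least-spec P? (suc n) i≤n p with P? 0
... | yes p₀ = p₀ , z≤n
least-spec P? (suc n) {zero}  _   p | no ¬p = ⊥-elim (¬p p)
least-spec P? (suc n) {suc i} i≤n p | no _ with least-spec (P? ∘ suc) n (s≤s⁻¹ i≤n) p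
... | q , le = q , s≤s le

mem? : ∀ {w h} (g : Grid w h) c → Dec (Mem g c)
mem? {w} {h} g (x , y) with x <? w | y <? h
... | no ¬p | _     = no λ (p , _) → ¬p p
... | yes _ | no ¬q = no λ (_ , q , _) → ¬q q
... | yes p | yes q = map′ (λ t → p , q , t)
  (λ (p′ , q′ , t) → subst₂ (λ p q → T (lookup (lookup g (fromℕ< p)) (fromℕ< q))) (<-irrelevant p′ p) (<-irrelevant q′ q) t)
  (T? _)

module _ {a h} (g : Grid (suc a) h) where

  FullRow : ℕ → Set
  FullRow y = Mem g (0 , y) × Mem g (a , y)

  fullRow? : Decidable FullRow
  fullRow? y = mem? g (0 , y) ×-dec mem? g (a , y)

  leftIndent rightIndent : ℕ → ℕ
  leftIndent y  = least (λ x → mem? g (x , y)) a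
  rightIndent y = least (λ i → mem? g (a ∸ i , y)) a

  indents : ℕ → Row
  indents y = rightIndent y , leftIndent y

  lowestFull : ℕ
  lowestFull = least fullRow? h

  module _ (touches : TouchesSides g) (convex : Convex g) (ascending : Ascending g) (centered : Centered g) where

    private
      b : ℕ
      b = lowestFull

      b-full : FullRow b
      b-full = proj₁ (least-spec fullRow? h (<⇒≤ (proj₁ (proj₂ (proj₁ (proj₂ centered))))) (proj₂ centered))

      b<h : b < h
      b<h = proj₁ (proj₂ (proj₁ b-full))

      base-cell : ∀ {x} → x ≤ a → Mem g (x , b)
      base-cell {x} x≤a = proj₁ convex 0 x a b z≤n x≤a (proj₁ b-full) (proj₂ b-full)

      column-base : ∀ {x y} → Mem g (x , y) → Mem g (x , b)
      column-base (s≤s x≤a , _) = base-cell x≤a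

      -- The column of a cell in the bottom or top row also meets the full row `b`, and column
      -- convexity fills what lies between.
      nonempty : ∀ {y} → y < h → ∃ λ x → Mem g (x , y)
      nonempty {y} y<h with ≤-total y b
      ... | inj₁ y≤b = let _ , _ , (x , m) , _ = touches in
        x , proj₂ convex x 0 y b z≤n y≤b m (column-base m)
      ... | inj₂ b≤y = let _ , _ , _ , (x , m) = touches in
        x , proj₂ convex x b y (h ∸ 1) b≤y (∸-monoˡ-≤ 1 y<h) (column-base m) m

      left-spec : ∀ {x y} → Mem g (x , y) → Mem g (leftIndent y , y) × leftIndent y ≤ x
      left-spec {x} {y} m@(s≤s x≤a , _) = least-spec (λ x → mem? g (x , y)) a x≤a m

      right-spec : ∀ {x y} → Mem g (x , y) → Mem g (a ∸ rightIndent y , y) × rightIndent y + x ≤ a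
      right-spec {x} {y} m@(s≤s x≤a , _)
        with least-spec (λ i → mem? g (a ∸ i , y)) a (m∸n≤m a x) (subst (λ x → Mem g (x , y)) (sym (m∸[m∸n]≡n x≤a)) m)
      ... | m′ , le = m′ , ≤-trans (+-monoˡ-≤ x le) (≤-reflexive (m∸n+n≡m x≤a))

      mem⇒ : ∀ {x y} → Mem g (x , y) → y < h × Inside a (indents y) x
      mem⇒ m@(_ , y<h , _) = y<h , proj₂ (left-spec m) , proj₂ (right-spec m)

      ⇒mem : ∀ {x y} → y < h × Inside a (indents y) x → Mem g (x , y)
      ⇒mem {x} {y} (y<h , l , r) with nonempty y<h
      ... | x₀ , m = proj₁ convex (leftIndent y) x (a ∸ rightIndent y) y l
        (m+n≤o⇒m≤o∸n x (≤-trans (≤-reflexive (+-comm x _)) r)) (proj₁ (left-spec m)) (proj₁ (right-spec m))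

      indents-fit : ∀ {y} → y < h → weight (indents y) ≤ a
      indents-fit {y} y<h with nonempty y<h
      ... | x , m = proj₂ (right-spec (proj₁ (left-spec m)))

      indents-base : indents b ≡ (0 , 0)
      indents-base = cong₂ _,_
        (n≤0⇒n≡0 (+-cancelʳ-≤ a _ 0 (proj₂ (right-spec (proj₂ b-full)))))
        (n≤0⇒n≡0 (proj₂ (left-spec (proj₁ b-full))))

      indents-≼ : ∀ {y y′} → y′ < h → (∀ {x} → Mem g (x , y′) → Mem g (x , y)) → indents y ≼ indents y′
      indents-≼ {y} {y′} y′<h ⊇ with nonempty y′<h
      ... | x , m =
        +-cancelʳ-≤ (a ∸ rightIndent y′) _ _
          (≤-trans (proj₂ (right-spec (⊇ (proj₁ (right-spec m)))))
            (≤-reflexive (sym (m+[n∸m]≡n {rightIndent y′} (≤-trans (m≤m+n _ x) (proj₂ (right-spec m))))))) ,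
        proj₂ (left-spec (⊇ (proj₁ (left-spec m))))

      -- If neither indentation is monotone, the last cell of row y and the first
      -- cell of row y′ are joined by an NWN path, but neither of the corners a
      -- path with one turn would use is in the polyomino.
      indents-compatible : ∀ {y y′} → y < b → b < y′ → y′ < h → Compatible 0 (indents y) (indents y′)
      indents-compatible {y} {y′} y<b b<y′ y′<h with rightIndent y′ ≤? rightIndent y | leftIndent y ≤? leftIndent y′
      ... | yes p | _     = byRight (≤-trans p (m≤m+n _ 0))
      ... | no _  | yes q = byLeft (≤-trans q (m≤m+n _ 0))
      ... | no ¬p | no ¬q with nonempty (<-trans y<b b<h) | nonempty y′<h
      ... | x , m | x′ , m′ = ⊥-elim (absurd (path⇒corner (proj₁ (proj₂ short)) (proj₂ (proj₂ short))))
        where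
        e = a ∸ rightIndent y
        f = leftIndent y′
        r≤a : rightIndent y ≤ a
        r≤a = ≤-trans (m≤m+n _ _) (proj₂ (right-spec m))
        eₘ : Mem g (e , y)
        eₘ = proj₁ (right-spec m)
        fₘ : Mem g (f , y′)
        fₘ = proj₁ (left-spec m′)
        f≤e : f ≤ e
        f≤e = ≤-trans (<⇒≤ (≰⇒> ¬q)) (proj₂ (left-spec eₘ))
        short = ascending (e , y) (f , y′) (_ ,
          go-north convex (b ∸ y) (m∸n+n≡m (<⇒≤ y<b)) eₘ
            (go-west convex (e ∸ f) (m∸n+n≡m f≤e) (column-base eₘ)
              (go-north convex (y′ ∸ b) (m∸n+n≡m (<⇒≤ b<y′)) (column-base fₘ) (here fₘ))))
        absurd : ¬ Corner g (e , y) (f , y′)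
        absurd (inj₁ c) = ¬p (+-cancelʳ-≤ e _ _ (≤-trans (proj₂ (right-spec c)) (≤-reflexive (sym (m+[n∸m]≡n r≤a)))))
        absurd (inj₂ c) = ¬q (proj₂ (left-spec c))

    indents-profile : Profile g lowestFull indents
    indents-profile = record
      { base<h     = b<h
      ; mem        = mk⇔ mem⇒ ⇒mem
      ; fits       = indents-fit
      ; full       = indents-base
      ; below      = λ {y} {y′} y≤y′ y′≤b → indents-≼ (≤-<-trans (≤-trans y≤y′ y′≤b) b<h)
                       λ {x} m → proj₂ convex x y y′ b y≤y′ y′≤b m (column-base m)
      ; above      = λ {y} {y′} b≤y y≤y′ y′<h → indents-≼ y′<h
                       λ {x} m → proj₂ convex x b y y′ b≤y y≤y′ (column-base m) m
      ; compatible = indents-compatible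
      }

    lowestFull-minimal : ∀ {y} → y < lowestFull → indents y ≢ (0 , 0)
    lowestFull-minimal {y} y<b eq = <-irrefl refl (<-≤-trans y<b (proj₂ (least-spec fullRow? h (<⇒≤ y<h)
      (⇒mem (y<h , subst (λ r → Inside a r 0) (sym eq) (z≤n , z≤n)) ,
       ⇒mem (y<h , subst (λ r → Inside a r a) (sym eq) (z≤n , ≤-refl))))))
      where
      y<h = <-trans y<b b<h

-- From codes to grids

-- The default is never seen, since cells lie in rows within range; totality frees `nth-ʳ++-past`
-- from a bound.
nth : List Row → ℕ → Row
nth []       _       = 0 , 0
nth (x ∷ xs) zero    = x
nth (x ∷ xs) (suc i) = nth xs i

all-nth : ∀ {P : Row → Set} {xs} → All P xs → ∀ {i} → i < length xs → P (nth xs i)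
all-nth (p ∷ ps) {zero}  _       = p
all-nth (p ∷ ps) {suc i} (s≤s l) = all-nth ps l

nested-nth : ∀ {xs} → AllPairs _≼_ xs → ∀ {i j} → i ≤ j → j < length xs → nth xs i ≼ nth xs j
nested-nth (h ∷ n) {zero}  {zero}  _       _       = ≤-refl , ≤-refl
nested-nth (h ∷ n) {zero}  {suc j} _       (s≤s l) = all-nth h l
nested-nth (h ∷ n) {suc i} {suc j} (s≤s p) (s≤s l) = nested-nth n p l

nth-ʳ++-past : ∀ xs {acc} k → nth (xs ʳ++ acc) (length xs + k) ≡ nth acc k
nth-ʳ++-past []             k = refl
nth-ʳ++-past (x ∷ xs) {acc} k =
  trans (cong (nth (xs ʳ++ (x ∷ acc))) (sym (+-suc (length xs) k))) (nth-ʳ++-past xs (suc k))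

nth-ʳ++-before : ∀ xs {r acc} {y j} → y + j ≡ length xs → nth (xs ʳ++ (r ∷ acc)) y ≡ nth (r ∷ xs) j
nth-ʳ++-before xs {r} {acc} {y} {zero} eq =
  trans (cong (nth (xs ʳ++ (r ∷ acc))) (trans (sym (+-identityʳ y)) (trans eq (sym (+-identityʳ _))))) (nth-ʳ++-past xs 0)
nth-ʳ++-before [] {y = y} {suc j} eq with trans (sym (+-suc y j)) eq
... | ()
nth-ʳ++-before (x ∷ xs) {y = y} {suc j} eq = nth-ʳ++-before xs (suc-injective (trans (sym (+-suc y j)) eq))

nth-ext : ∀ {xs ys} → length xs ≡ length ys → (∀ {i} → i < length xs → nth xs i ≡ nth ys i) → xs ≡ ys
nth-ext {[]}     {[]}     _  _ = refl
nth-ext {x ∷ xs} {y ∷ ys} eq h = cong₂ _∷_ (h (s≤s z≤n)) (nth-ext (suc-injective eq) (h ∘ s≤s))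

nth-applyUpTo : ∀ f {n i} → i < n → nth (applyUpTo f n) i ≡ f i
nth-applyUpTo f {suc n} {zero}  _       = refl
nth-applyUpTo f {suc n} {suc i} (s≤s l) = nth-applyUpTo (f ∘ suc) l

nth-applyDownFrom : ∀ f n {i} → i ≤ n → nth (applyDownFrom f (suc n)) i ≡ f (n ∸ i)
nth-applyDownFrom f n       {zero}  _       = refl
nth-applyDownFrom f (suc n) {suc i} (s≤s l) = nth-applyDownFrom f n l

ShapeMem : Shape → Cell → Set
ShapeMem (_ , _ , g) = Mem g

grid : ∀ w h → (ℕ → ℕ → Bool) → Grid w h
grid w h f = tabulate λ x → tabulate λ y → f (toℕ x) (toℕ y)

lookup-grid : ∀ {w h} f {x y} (p : x < w) (q : y < h) →
              lookup (lookup (grid w h f) (fromℕ< p)) (fromℕ< q) ≡ f x y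
lookup-grid {w} {h} f {x} {y} p q = begin
  lookup (lookup (grid w h f) (fromℕ< p)) (fromℕ< q)
    ≡⟨ cong (λ v → lookup v (fromℕ< q)) (lookup∘tabulate _ (fromℕ< p)) ⟩
  lookup (tabulate λ y → f (toℕ (fromℕ< p)) (toℕ y)) (fromℕ< q)
    ≡⟨ lookup∘tabulate _ (fromℕ< q) ⟩
  f (toℕ (fromℕ< p)) (toℕ (fromℕ< q))
    ≡⟨ cong₂ f (toℕ-fromℕ< p) (toℕ-fromℕ< q) ⟩
  f x y ∎
  where open ≡-Reasoning

tabulate-lookup-grid : ∀ {w h} (g : Grid w h) → tabulate (λ x → tabulate λ y → lookup (lookup g x) y) ≡ g
tabulate-lookup-grid g = trans (tabulate-cong (λ x → tabulate∘lookup (lookup g x))) (tabulate∘lookup g)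

mem-bit : ∀ {w h} (g : Grid w h) (x : Fin w) (y : Fin h) → Mem g (toℕ x , toℕ y) ⇔ T (lookup (lookup g x) y)
mem-bit {w} {h} g x y = mk⇔
  (λ (p , q , t) → subst₂ bit (fromℕ<-toℕ x p) (fromℕ<-toℕ y q) t)
  (λ t → toℕ<n x , toℕ<n y , subst₂ bit (sym (fromℕ<-toℕ x (toℕ<n x))) (sym (fromℕ<-toℕ y (toℕ<n y))) t)
  where
  bit : Fin w → Fin h → Set
  bit x y = T (lookup (lookup g x) y)

T-ext : ∀ {b c} → (T b → T c) → (T c → T b) → b ≡ c
T-ext {true}  {true}  _ _ = refl
T-ext {false} {false} _ _ = refl
T-ext {true}  {false} f _ = ⊥-elim (f tt)
T-ext {false} {true}  _ f = ⊥-elim (f tt)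

grid-ext : ∀ {w h} {g g′ : Grid w h} → (∀ {c} → Mem g c → Mem g′ c) → (∀ {c} → Mem g′ c → Mem g c) → g ≡ g′
grid-ext {g = g} {g′} f f′ = begin
  g                                                     ≡⟨ tabulate-lookup-grid g ⟨
  tabulate (λ x → tabulate λ y → lookup (lookup g x) y)  ≡⟨ tabulate-cong (λ x → tabulate-cong λ y →
    T-ext (to (mem-bit g′ x y) ∘ f ∘ from (mem-bit g x y)) (to (mem-bit g x y) ∘ f′ ∘ from (mem-bit g′ x y))) ⟩
  tabulate (λ x → tabulate λ y → lookup (lookup g′ x) y) ≡⟨ tabulate-lookup-grid g′ ⟩
  g′                                                    ∎
  where open ≡-Reasoning

inside? : ∀ a r x → Dec (Inside a r x)
inside? a (i , j) x = (j ≤? x) ×-dec (i + x ≤? a)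

-- Rows from bottom to top. Both stacks are stored outwards from the base, hence the reversal of the
-- lower one.
rowList : Code → List Row
rowList (code a xs ys) = xs ʳ++ ((0 , 0) ∷ ys)

decodeGrid : ∀ c → Grid (suc (Code.excess c)) (length (rowList c))
decodeGrid c = grid _ _ λ x y → ⌊ inside? (Code.excess c) (nth (rowList c) y) x ⌋

decode : Code → Shape
decode c = suc (Code.excess c) , length (rowList c) , decodeGrid c

mem-decode : ∀ c {x y} → Mem (decodeGrid c) (x , y) ⇔
             (y < length (rowList c) × Inside (Code.excess c) (nth (rowList c) y) x)
mem-decode c {x} {y} = mk⇔
  (λ (p , q , t) → q , toWitness (subst T (lookup-grid cell p q) t))
  (λ (q , i) → let p = s≤s (≤-trans (m≤n+m x _) (proj₂ i)) in
    p , q , subst T (sym (lookup-grid cell p q)) (fromWitness i))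
  where
  cell : ℕ → ℕ → Bool
  cell x y = ⌊ inside? (Code.excess c) (nth (rowList c) y) x ⌋

height : ∀ c → length (rowList c) ≡ length (Code.below c) + suc (length (Code.above c))
height (code a xs ys) = length-ʳ++ xs

valid-profile : ∀ {p q z m c} → Valid p q z m 0 c → Profile (decodeGrid c) (length (Code.below c)) (nth (rowList c))
valid-profile {c = c@(code a xs ys)} (valid s sb st o _ _ _) = record
  { base<h     = subst (b <_) (sym (height c)) (m<m+n b (s≤s z≤n))
  ; mem        = mem-decode c
  ; fits       = λ {y} y<h → [ (λ y≤b → subst (λ r → weight r ≤ a) (sym (before y≤b)) (all-nth (Stack.fits X) (s≤s (m∸n≤m b y))))
                             , (λ b≤y → subst (λ r → weight r ≤ a) (sym (past b≤y)) (all-nth (Stack.fits Y) (above-length y<h b≤y))) ]′ (≤-total y b)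
  ; full       = trans (before ≤-refl) (cong (nth ((0 , 0) ∷ xs)) (n∸n≡0 b))
  ; below      = λ {y} {y′} y≤y′ y′≤b → subst₂ _≼_ (sym (before y′≤b)) (sym (before (≤-trans y≤y′ y′≤b)))
                   (nested-nth (Stack.nested X) (∸-monoʳ-≤ b y≤y′) (s≤s (m∸n≤m b y)))
  ; above      = λ {y} {y′} b≤y y≤y′ y′<h → subst₂ _≼_ (sym (past b≤y)) (sym (past (≤-trans b≤y y≤y′)))
                   (nested-nth (Stack.nested Y) (∸-monoˡ-≤ b y≤y′) (above-length y′<h (≤-trans b≤y y≤y′)))
  ; compatible = λ {y} {y′} y<b b<y′ y′<h → subst₂ (Compatible 0) (sym (before (<⇒≤ y<b))) (sym (past (<⇒≤ b<y′)))
                   (all-nth (all-nth (compatible-full-below ∷ compatible-full-above o) (s≤s (m∸n≤m b y))) (above-length y′<h (<⇒≤ b<y′)))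
  }
  where
  b = length xs
  -- With the base row put at the head of either stack, the distance from `b` is the index on both
  -- sides.
  X : Stack a ((0 , 0) ∷ xs)
  X = stack-∷ sb
  Y : Stack a ((0 , 0) ∷ ys)
  Y = stack-∷ st
  before : ∀ {y} → y ≤ b → nth (rowList c) y ≡ nth ((0 , 0) ∷ xs) (b ∸ y)
  before y≤b = nth-ʳ++-before xs (m+[n∸m]≡n y≤b)
  past : ∀ {y} → b ≤ y → nth (rowList c) y ≡ nth ((0 , 0) ∷ ys) (y ∸ b)
  past {y} b≤y = trans (cong (nth (rowList c)) (sym (m+[n∸m]≡n b≤y))) (nth-ʳ++-past xs (y ∸ b))
  above-length : ∀ {y} → y < length (rowList c) → b ≤ y → y ∸ b < suc (length ys)
  above-length {y} y<h b≤y = +-cancelˡ-< b _ _ (subst₂ _<_ (sym (m+[n∸m]≡n b≤y)) (height c) y<h)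

decode-sound : ∀ {p q z m c} → Valid p q z m 0 c → CenteredAscendingOfSemiPerimeter (2 + m) (decode c)
decode-sound {m = m} {c@(code a xs ys)} v =
  perimeter , (profile-touches P , profile-connected P , profile-convex P) , profile-ascending P , profile-centered P
  where
  P = valid-profile v
  perimeter : suc a + length (rowList c) ≡ 2 + m
  perimeter = begin
    suc a + length (rowList c)              ≡⟨ cong (suc a +_) (trans (height c) (+-suc (length xs) (length ys))) ⟩
    suc a + suc (length xs + length ys)     ≡⟨ +-suc (suc a) _ ⟩
    2 + (a + (length xs + length ys))       ≡⟨ cong (2 +_) (Valid.size v) ⟩
    2 + m                                   ∎
    where open ≡-Reasoning

-- Distinct codes give distinct grids

inside-determines : ∀ {a r r′} → weight r ≤ a → weight r′ ≤ a → (∀ {x} → Inside a r x → Inside a r′ x) → r′ ≼ r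
inside-determines {a} {i , j} {i′ , j′} w w′ f =
  +-cancelʳ-≤ (a ∸ i) i′ i (≤-trans (proj₂ (f (m+n≤o⇒m≤o∸n j (≤-trans (≤-reflexive (+-comm j i)) w) , ≤-reflexive i+[a∸i])))
    (≤-reflexive (sym i+[a∸i]))) ,
  proj₁ (f (≤-refl , w))
  where
  i+[a∸i] : i + (a ∸ i) ≡ a
  i+[a∸i] = m+[n∸m]≡n (≤-trans (m≤m+n i j) w)

≼-antisym : ∀ {r r′} → r ≼ r′ → r′ ≼ r → r ≡ r′
≼-antisym (p , q) (p′ , q′) = cong₂ _,_ (≤-antisym p p′) (≤-antisym q q′)

split-first : ∀ {A : Set} {z : A} {us us′ vs vs′} → All (_≢ z) us → All (_≢ z) us′ →
              us ++ z ∷ vs ≡ us′ ++ z ∷ vs′ → us ≡ us′ × vs ≡ vs′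
split-first []       []       refl = refl , refl
split-first []       (n ∷ _)  eq   = ⊥-elim (n (sym (proj₁ (∷-injective eq))))
split-first (n ∷ _)  []       eq   = ⊥-elim (n (proj₁ (∷-injective eq)))
split-first (_ ∷ ns) (_ ∷ ns′) eq with ∷-injective eq
... | refl , eq′ with split-first ns ns′ eq′
... | refl , refl = refl , refl

no-full-row : ∀ {a xs} → Stack a xs → ¬ StartsFull xs → All (_≢ (0 , 0)) xs
no-full-row {xs = []}     _             n = []
no-full-row {xs = x ∷ xs} (_ , (h ∷ _)) n =
  n ∷ All.map (λ { (p , q) refl → n (cong₂ _,_ (n≤0⇒n≡0 p) (n≤0⇒n≡0 q)) }) h

all-reverse : ∀ {A : Set} {P : A → Set} {xs : List A} → All P xs → All P (reverse xs)
all-reverse ps = All.tabulate (All.lookup ps ∘ reverse⁻)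

-- The base is the first full row from the bottom, so the list itself shows where it is to be cut.
rowList-injective : ∀ {a xs ys xs′ ys′} → All (_≢ (0 , 0)) xs → All (_≢ (0 , 0)) xs′ →
                    rowList (code a xs ys) ≡ rowList (code a xs′ ys′) → code a xs ys ≡ code a xs′ ys′
rowList-injective {a} {xs} {ys} {xs′} {ys′} n n′ eq
  with split-first (all-reverse n) (all-reverse n′) (trans (sym (ʳ++-defn xs)) (trans eq (ʳ++-defn xs′)))
... | eq₁ , refl = cong (λ xs → code a xs ys) (reverse-injective eq₁)

-- The end cells of each row determine its indentations. The raised `z` fixes the base, for which
-- any full row could otherwise serve.
decode-injective : ∀ {p q m c p′ q′ m′ c′} → Valid p q true m 0 c → Valid p′ q′ true m′ 0 c′ →
                   decode c ≡ decode c′ → c ≡ c′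
decode-injective {c = c@(code a xs ys)} {c′ = c′@(code a′ xs′ ys′)} v v′ eq with suc-injective (cong proj₁ eq)
... | refl = rowList-injective (no-full-row (Valid.below-stack v) (Valid.below-notFull v tt))
                               (no-full-row (Valid.below-stack v′) (Valid.below-notFull v′ tt))
                               (nth-ext heights λ y<h → ≼-antisym
                                 (rows-≼ (subst (_ <_) heights y<h) y<h (λ {m} → subst (λ s → ShapeMem s m) (sym eq)))
                                 (rows-≼′ y<h (subst (_ <_) heights y<h) (λ {m} → subst (λ s → ShapeMem s m) eq)))
  where
  heights : length (rowList c) ≡ length (rowList c′)
  heights = cong (proj₁ ∘ proj₂) eq
  rows-≼ : ∀ {y} → y < length (rowList c′) → y < length (rowList c) →
           (∀ {m} → Mem (decodeGrid c′) m → Mem (decodeGrid c) m) → nth (rowList c) y ≼ nth (rowList c′) y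
  rows-≼ y<h′ y<h f = inside-determines (Profile.fits (valid-profile v′) y<h′) (Profile.fits (valid-profile v) y<h)
    λ i → proj₂ (to (mem-decode c) (f (from (mem-decode c′) (y<h′ , i))))
  rows-≼′ : ∀ {y} → y < length (rowList c) → y < length (rowList c′) →
           (∀ {m} → Mem (decodeGrid c) m → Mem (decodeGrid c′) m) → nth (rowList c′) y ≼ nth (rowList c) y
  rows-≼′ y<h y<h′ f = inside-determines (Profile.fits (valid-profile v) y<h) (Profile.fits (valid-profile v′) y<h′)
    λ i → proj₂ (to (mem-decode c′) (f (from (mem-decode c) (y<h , i))))

-- Every centered ascending polyomino comes from a code

module _ {a b k} {g : Grid (suc a) (b + suc k)} {rows} (P : Profile g b rows)
         (minimal : ∀ {y} → y < b → rows y ≢ (0 , 0)) where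
  open Profile P

  encode : Code
  encode = code a (applyDownFrom rows b) (applyUpTo (λ i → rows (suc b + i)) k)

  private
    above<h : ∀ {i} → i < k → suc b + i < b + suc k
    above<h {i} i<k = ≤-trans (≤-reflexive (cong suc (sym (+-suc b i)))) (+-monoʳ-< b (s≤s i<k))

    below<h : ∀ {y} → y < b → y < b + suc k
    below<h y<b = <-≤-trans y<b (m≤m+n b _)

    starts : ∀ c → c ≤ b → ¬ StartsFull (applyDownFrom rows c)
    starts zero    _   ()
    starts (suc c) c<b eq = minimal c<b eq

  encode-valid : Valid false false true (a + (b + k)) 0 encode
  encode-valid = valid
    (cong (a +_) (cong₂ _+_ (length-applyDownFrom rows b) (length-applyUpTo _ k)))
    (All.applyDownFrom⁺₁ rows b (fits ∘ below<h) ,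
     AllPairs.applyDownFrom⁺₁ rows b λ j<i i<b → below (<⇒≤ j<i) (<⇒≤ i<b))
    (All.applyUpTo⁺₁ _ k (fits ∘ above<h) ,
     AllPairs.applyUpTo⁺₁ _ k λ {i} i<j j<k → above (m≤n⇒m≤1+n (m≤m+n b i)) (+-monoʳ-≤ (suc b) (<⇒≤ i<j)) (above<h j<k))
    (All.applyDownFrom⁺₁ rows b λ i<b → All.applyUpTo⁺₁ _ k λ {j} j<k → compatible i<b (s≤s (m≤m+n b j)) (above<h j<k))
    (λ ()) (λ ()) (λ _ → starts b ≤-refl)

  encode-height : length (rowList encode) ≡ b + suc k
  encode-height = trans (height encode)
    (cong₂ (λ s t → s + suc t) (length-applyDownFrom rows b) (length-applyUpTo _ k))

  encode-row : ∀ {y} → y < b + suc k → nth (rowList encode) y ≡ rows y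
  encode-row {y} y<h with ≤-<-connex y b
  ... | inj₁ y≤b = begin
    nth (rowList encode) y
      ≡⟨ nth-ʳ++-before (applyDownFrom rows b) (trans (m+[n∸m]≡n y≤b) (sym (length-applyDownFrom rows b))) ⟩
    nth ((0 , 0) ∷ applyDownFrom rows b) (b ∸ y)
      ≡⟨ cong (λ r → nth (r ∷ applyDownFrom rows b) (b ∸ y)) (sym full) ⟩
    nth (applyDownFrom rows (suc b)) (b ∸ y)
      ≡⟨ nth-applyDownFrom rows b (m∸n≤m b y) ⟩
    rows (b ∸ (b ∸ y))
      ≡⟨ cong rows (m∸[m∸n]≡n y≤b) ⟩
    rows y ∎
    where open ≡-Reasoning
  ... | inj₂ b<y with m≤n⇒∃[o]m+o≡n b<y
  ... | i , refl = begin
    nth (rowList encode) (suc (b + i))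
      ≡⟨ cong (nth (rowList encode)) (sym (trans (cong (_+ suc i) (length-applyDownFrom rows b)) (+-suc b i))) ⟩
    nth (rowList encode) (length (applyDownFrom rows b) + suc i)
      ≡⟨ nth-ʳ++-past (applyDownFrom rows b) (suc i) ⟩
    nth (applyUpTo (λ i → rows (suc b + i)) k) i
      ≡⟨ nth-applyUpTo (λ i → rows (suc b + i)) (s≤s⁻¹ (+-cancelˡ-< b (suc i) (suc k) (subst (_< b + suc k) (sym (+-suc b i)) y<h))) ⟩
    rows (suc (b + i)) ∎
    where open ≡-Reasoning

  decode-encode : (suc a , b + suc k , g) ≡ decode encode
  decode-encode = shape-ext (sym encode-height)
    (λ m → let y<h , i = to mem m in
      from (mem-decode encode) (subst (_ <_) (sym encode-height) y<h , subst (λ r → Inside a r _) (sym (encode-row y<h)) i))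
    (λ m → let y<h , i = to (mem-decode encode) m
               y<h′ = subst (_ <_) encode-height y<h in
      from mem (y<h′ , subst (λ r → Inside a r _) (encode-row y<h′) i))
    where
    shape-ext : ∀ {w h h′} {g : Grid w h} {g′ : Grid w h′} → h ≡ h′ →
                (∀ {c} → Mem g c → Mem g′ c) → (∀ {c} → Mem g′ c → Mem g c) →
                _≡_ {A = Shape} (w , h , g) (w , h′ , g′)
    shape-ext {w} {h} refl f f′ = cong (λ g → w , h , g) (grid-ext f f′)

decode-complete : ∀ {m s} → CenteredAscendingOfSemiPerimeter (2 + m) s →
                  ∃ λ c → Valid false false true m 0 c × s ≡ decode c
decode-complete {s = zero , _} (_ , (((_ , () , _) , _) , _) , _)
decode-complete {m} {suc a , h , g} (perimeter , (touches , _ , convex) , ascending , centered)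
  with indents-profile g touches convex ascending centered
     | (λ {y} → lowestFull-minimal g touches convex ascending centered {y})
... | P | minimal with m≤n⇒∃[o]m+o≡n (Profile.base<h P)
... | k , eq = go P minimal (trans (+-suc (lowestFull g) k) eq) perimeter
  where
  -- The base row is made a variable: `lowestFull g` depends on the height, so the equation for the
  -- height could not be matched directly.
  go : ∀ {b h g rows} → Profile {a} {h} g b rows → (∀ {y} → y < b → rows y ≢ (0 , 0)) → b + suc k ≡ h →
       suc a + h ≡ 2 + m → ∃ λ c → Valid false false true m 0 c × (suc a , h , g) ≡ decode c
  go {b} P minimal refl perimeter = encode P minimal ,
    subst (λ m → Valid false false true m 0 (encode P minimal)) size (encode-valid P minimal) , decode-encode P minimal
    where
    size : a + (b + k) ≡ m
    size = suc-injective (suc-injective (trans (sym (trans (cong (suc a +_) (+-suc b k)) (+-suc (suc a) (b + k)))) perimeter))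

-- The count

-- Injectivity is asked only on the list, because `decode` is injective only on codes whose base is
-- the lowest full row.
unique-map : ∀ {A B : Set} (f : A → B) {xs} → (∀ {x y} → x ∈ xs → y ∈ xs → f x ≡ f y → x ≡ y) →
             Unique xs → Unique (map f xs)
unique-map f inj []       = []
unique-map f inj (h ∷ u) = All.map⁺ (All.tabulate λ y∈ eq → All.lookup h y∈ (inj (here refl) (there y∈) eq)) ∷
  unique-map f (λ x∈ y∈ → inj (there x∈) (there y∈)) u

theorem3 : ∀ n → 2 ≤ n →
    ∃ λ hn → HasCount (CenteredAscendingOfSemiPerimeter n) hn ×
    hn * (n ∸ 1) ≡ (3 * n ∸ 5) * ((2 * n ∸ 5) C (n ∸ 2))
-- The prime makes the base the lowest full row, and `δ = 0` is compatibility in its original form.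
theorem3 (suc (suc m)) (s≤s (s≤s z≤n)) = free′ m 0 ,
  (map decode shapes , unique-map decode injective (codes-unique false false true m 0) , characterised ,
   trans (length-map decode shapes) (length-codes false false true m 0)) ,
  free′-closed m
  where
  shapes : List Code
  shapes = codes false false true m 0
  injective : ∀ {c c′} → c ∈ shapes → c′ ∈ shapes → decode c ≡ decode c′ → c ≡ c′
  injective c∈ c′∈ = decode-injective (codes-valid false false true m 0 c∈) (codes-valid false false true m 0 c′∈)
  characterised : ∀ s → (s ∈ map decode shapes) ⇔ CenteredAscendingOfSemiPerimeter (2 + m) s
  characterised s = mk⇔ sound complete
    where
    sound : s ∈ map decode shapes → CenteredAscendingOfSemiPerimeter (2 + m) s
    sound s∈ with ∈-map⁻ decode s∈
    ... | c , c∈ , refl = decode-sound (codes-valid false false true m 0 c∈)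
    complete : CenteredAscendingOfSemiPerimeter (2 + m) s → s ∈ map decode shapes
    complete P with decode-complete P
    ... | c , v , refl = ∈-map⁺ decode (codes-complete false false true m 0 v)
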